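{- For every prime $p\ge3$ and all integers $n,k\ge1$, the sequence $\mathbf{B}$ satisfies $B_{np^k}\equiv B_{np^{k-1}}\pmod{p^{2k}}$.
   Context: $B_n$ is Zagier's sequence $\mathbf{B}$, defined by $B_{ -1}=0$, $B_0=1$ and $(n+1)^2B_{n+1}-(9n^2+9n+3)B_n+27n^2B_{n-1}=0$ for $n\ge0$; equivalently $B_n=\sum_{k=0}^{\lfloor n/3\rfloor}(-1)^k3^{n-3k}\binom n{3k}\binom{3k}{2k}\binom{2k}k$. -}

module Defs where

open import Data.Nat as ℕ using (ℕ; zero; suc; _∸_)
open import Data.Nat.Combinatorics using (_C_)
open import Data.Integer as ℤ using (ℤ; +_; -_)

sumTo : ℕ → (ℕ → ℤ) → ℤ
sumTo zero    f = f 0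
sumTo (suc m) f = sumTo m f ℤ.+ f (suc m)

sign : ℕ → ℤ
sign zero    = + 1
sign (suc k) = - sign k

-- Zagier's sequence B:
-- B n = Σ_{k=0}^{⌊n/3⌋} (-1)^k 3^(n-3k) C(n,3k) C(3k,2k) C(2k,k)
B : ℕ → ℤ
B n = sumTo (n ℕ./ 3) λ k →
  sign k ℤ.* (+ (3 ℕ.^ (n ∸ 3 ℕ.* k)
                ℕ.* (n C (3 ℕ.* k))
                ℕ.* ((3 ℕ.* k) C (2 ℕ.* k))
                ℕ.* ((2 ℕ.* k) C k)))

module Submission where

-- Writing x³ + y³ + z³ − 3xyz = (x + y + z)(x + ωy + ω²z)(x + ω²y + ωz) with ω a primitive cube
-- root of unity, (−1)ⁿ B n is the coefficient of (xyz)ⁿ in the n-th power of the left-hand side.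
-- Expanding the n-th powers on the right makes it a sum over the 3×3 matrices of naturals whose
-- rows and columns all sum to n: the weight T of a matrix is the product of the multinomial
-- coefficients of its rows, twisted by a power ω^e. Let p^k divide n. Since n divides entry times
-- multinomial coefficient in each row, and the least p-adic valuation of the entries is attained
-- in at least two rows, T is divisible by p^(2k) unless p divides the whole matrix; for the same
-- reason T(pm) ≡ T(m) modulo p^(2k) when m has row sums n/p, by a Jacobsthal-type congruence.
-- Multiplying a matrix by p replaces ω^e by ω^(pe), which does not change the (rational) sum if
-- p ≠ 3. If p = 3, the error is 3 times the sum of T over the matrices with 3 ∤ e; the cyclic
-- rotation of the rows acts on these without fixed points, which provides the missing factor 3.

open import Defs
open import Data.Empty using (⊥-elim)
open import Data.Fin using (Fin; toℕ) renaming (zero to 0F; suc to sucF)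
open import Data.Fin.Properties using (all?)
open import Data.Integer as ℤ using (ℤ; +_; -_; 0ℤ; 1ℤ; _+_; _*_; _-_)
import Data.Integer.Divisibility as ℤ
open import Data.Integer.Divisibility.Signed
import Data.Integer.Properties as ℤ
open import Data.Integer.Tactic.RingSolver using (solve-∀)
open import Data.Nat as ℕ using (ℕ; zero; suc; z≤n; s≤s; _!; _^_; _∸_; _≥_)
open import Data.Nat.Combinatorics using (_C_; nCk≡n!/k![n-k]!; k>n⇒nCk≡0; k![n∸k]!∣n!; nCk+nC[k+1]≡[n+1]C[k+1])
import Data.Nat.Divisibility as ℕ
open import Data.Nat.DivMod using (_divMod_; result)
import Data.Nat.DivMod as ℕ
open import Data.Nat.Primality using (Prime; euclidsLemma; prime⇒irreducible; prime⇒nonTrivial; prime⇒nonZero)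
import Data.Nat.Properties as ℕ
import Data.Nat.Tactic.RingSolver as ℕ
open import Data.Product using (_×_; _,_; proj₁; proj₂)
open import Data.Sum using (_⊎_; inj₁; inj₂)
open import Function using (_∘_)
open import Relation.Binary.PropositionalEquality
open import Relation.Nullary using (¬_; yes; no)
open import Relation.Nullary.Decidable using (from-yes; _→-dec_)

-- Congruences and finite sums

-- Multiplying a row by p changes its trinomial coefficient by a quotient of products of residues
-- prime to p. If p^e divides the entries, this quotient is known to be 1 only modulo p^(2e+2),
-- which for small e falls short of the target. The weight itself must then supply the missing
-- p^(2j). A single row gives only p^j, so the comparison has to be made for whole matrices.
-- Arithmetic in ℤ[ω] is avoided: ω survives only as an exponent, and its powers are evaluated by
-- their traces, which are integers. This doubles the sums, and the 2 is cancelled at the end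
-- because p is odd. Polynomials enter through linear functionals on monomials, on which
-- multiplication acts by shifting exponents. The functional for the diagonal adds the coefficients
-- of all (xyz)^j; by homogeneity only j = n occurs in the n-th power, so xyz may be treated as 1.
-- Sums run over full boxes of entries, since the summands vanish unless all row and column sums
-- agree.

infix 4 _≡_[mod_]
record _≡_[mod_] (x y m : ℤ) : Set where
  constructor mod
  field diff : m ∣ x - y
open _≡_[mod_]

≡⇒mod : ∀ {m x y} → x ≡ y → x ≡ y [mod m ]
≡⇒mod {m} {x} refl = mod (divides 0ℤ (ℤ.+-inverseʳ x))

mod-trans : ∀ {m x y z} → x ≡ y [mod m ] → y ≡ z [mod m ] → x ≡ z [mod m ]
mod-trans {m} {x} {y} {z} (mod p) (mod q) = mod (subst (m ∣_) (lem x y z) (∣m∣n⇒∣m+n p q))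
  where
  lem : ∀ x y z → (x - y) + (y - z) ≡ x - z
  lem = solve-∀

mod-+ : ∀ {m x y x′ y′} → x ≡ y [mod m ] → x′ ≡ y′ [mod m ] → x + x′ ≡ y + y′ [mod m ]
mod-+ {m} {x} {y} {x′} {y′} (mod p) (mod q) =
  mod (subst (m ∣_) (lem x y x′ y′) (∣m∣n⇒∣m+n p q))
  where
  lem : ∀ x y x′ y′ → (x - y) + (x′ - y′) ≡ (x + x′) - (y + y′)
  lem = solve-∀

mod-* : ∀ {m x y x′ y′} → x ≡ y [mod m ] → x′ ≡ y′ [mod m ] → x * x′ ≡ y * y′ [mod m ]
mod-* {m} {x} {y} {x′} {y′} (mod p) (mod q) =
  mod (subst (m ∣_) (lem x y x′ y′) (∣m∣n⇒∣m+n (∣m⇒∣m*n x′ p) (∣n⇒∣m*n y q)))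
  where
  lem : ∀ x y x′ y′ → (x - y) * x′ + y * (x′ - y′) ≡ x * x′ - y * y′
  lem = solve-∀

∣⇒mod0 : ∀ {m x} → m ∣ x → x ≡ 0ℤ [mod m ]
∣⇒mod0 {m} {x} d = mod (subst (m ∣_) (sym (ℤ.+-identityʳ x)) d)

-- A sum is represented by the functional that it defines, so that a sum over matrices is a ninefold
-- product of `sumTo` and inherits its properties factor by factor.
Summation : Set → Set
Summation I = (I → ℤ) → ℤ

infixr 6 _⊗_
_⊗_ : ∀ {I J} → Summation I → Summation J → Summation (I × J)
(S ⊗ T) f = S λ i → T λ j → f (i , j)

record Linear {I : Set} (S : Summation I) : Set where
  field
    ext  : ∀ {f g} → (∀ i → f i ≡ g i) → S f ≡ S g
    add  : ∀ f g → S (λ i → f i + g i) ≡ S f + S g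
    mulʳ : ∀ f k → S (λ i → f i * k) ≡ S f * k

  mulˡ : ∀ k f → S (λ i → k * f i) ≡ k * S f
  mulˡ k f = trans (ext λ i → ℤ.*-comm k (f i)) (trans (mulʳ f k) (ℤ.*-comm (S f) k))

  zeros : ∀ {f} → (∀ i → f i ≡ 0ℤ) → S f ≡ 0ℤ
  zeros {f} h = trans (ext λ i → trans (h i) (sym (ℤ.*-zeroʳ (f i))))
                      (trans (mulʳ f 0ℤ) (ℤ.*-zeroʳ (S f)))

  sub : ∀ f g → S (λ i → f i - g i) ≡ S f - S g
  sub f g = trans (add f (λ i → - g i)) (cong (_+_ (S f))
    (trans (ext λ i → lem (g i)) (trans (mulʳ g (- 1ℤ)) (sym (lem (S g))))))
    where
    lem : ∀ x → - x ≡ x * (- 1ℤ)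
    lem = solve-∀

  dvd : ∀ {m f} → (∀ i → m ∣ f i) → m ∣ S f
  dvd {m} {f} h = divides (S (quotient ∘ h)) (trans (ext λ i → _∣_.equality (h i)) (mulʳ _ m))

  congMod : ∀ {m f g} → (∀ i → f i ≡ g i [mod m ]) → S f ≡ S g [mod m ]
  congMod {m} {f} {g} h = mod (subst (m ∣_) (sub f g) (dvd (λ i → diff (h i))))
open Linear

⊗-linear : ∀ {I J} {S : Summation I} {T : Summation J} → Linear S → Linear T → Linear (S ⊗ T)
⊗-linear LS LT .ext h = ext LS λ i → ext LT λ j → h (i , j)
⊗-linear LS LT .add f g = trans (ext LS λ i → add LT _ _) (add LS _ _)
⊗-linear LS LT .mulʳ f k = trans (ext LS λ i → mulʳ LT _ k) (mulʳ LS _ k)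

sumTo-linear : ∀ m → Linear (sumTo m)
sumTo-linear zero .ext h = h 0
sumTo-linear zero .add f g = refl
sumTo-linear zero .mulʳ f k = refl
sumTo-linear (suc m) .ext h = cong₂ _+_ (ext (sumTo-linear m) h) (h (suc m))
sumTo-linear (suc m) .add f g =
  trans (cong (_+ (f (suc m) + g (suc m))) (add (sumTo-linear m) f g))
        (lem (sumTo m f) (sumTo m g) (f (suc m)) (g (suc m)))
  where
  lem : ∀ a b c d → (a + b) + (c + d) ≡ (a + c) + (b + d)
  lem = solve-∀
sumTo-linear (suc m) .mulʳ f k =
  trans (cong (_+ (f (suc m) * k)) (mulʳ (sumTo-linear m) f k))
        (sym (ℤ.*-distribʳ-+ k (sumTo m f) (f (suc m))))

record Commute {I J : Set} (S : Summation I) (T : Summation J) : Set where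
  field swap : ∀ (f : I → J → ℤ) → S (λ i → T (λ j → f i j)) ≡ T (λ j → S (λ i → f i j))
open Commute

commute-sumTo : ∀ {I} {S : Summation I} → Linear S → ∀ m → Commute S (sumTo m)
commute-sumTo LS zero .swap f = refl
commute-sumTo {S = S} LS (suc m) .swap f =
  trans (add LS _ _) (cong (_+ S (λ i → f i (suc m))) (swap (commute-sumTo LS m) f))

commute-⊗ : ∀ {I J K} {S : Summation I} {T : Summation J} {T′ : Summation K} →
            Linear T → Commute S T → Commute S T′ → Commute S (T ⊗ T′)
commute-⊗ LT c c′ .swap f = trans (swap c _) (ext LT λ j → swap c′ _)

-- D i stands for "p divides the index i", and s for the multiplication of an index by p.
record Contracts {I : Set} (q : ℤ) (D : I → Set) (s : I → I) (S S′ : Summation I) : Set where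
  field contract : ∀ f → (∀ i → ¬ D i → q ∣ f i) → S f ≡ S′ (f ∘ s) [mod q ]
open Contracts

-- A pair is bad as soon as one component is. A bad `i` makes the whole inner sum divisible by `q`;
-- at the indices `s i` that remain, the inner sum is contracted in turn.
⊗-contracts : ∀ {I J q D E s t} {S S′ : Summation I} {T T′ : Summation J} →
  Linear S′ → Linear T → Contracts q D s S S′ → Contracts q E t T T′ →
  Contracts q (λ (i , j) → D i × E j) (λ (i , j) → s i , t j) (S ⊗ T) (S′ ⊗ T′)
⊗-contracts LS′ LT cS cT .contract f h = mod-trans
  (contract cS _ λ i ¬d → dvd LT λ j → h (i , j) (¬d ∘ proj₁))
  (congMod LS′ λ i → contract cT _ λ j ¬e → h (_ , j) (¬e ∘ proj₂))

sumTo-contracts : ∀ p q m → .{{ℕ.NonZero p}} →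
  Contracts q (p ℕ.∣_) (p ℕ.*_) (sumTo (p ℕ.* m)) (sumTo m)
sumTo-contracts p q zero .contract f h rewrite ℕ.*-zeroʳ p = ≡⇒mod refl
sumTo-contracts p@(suc p′) q (suc m) .contract f h =
  mod-trans (≡⇒mod (cong (λ n → sumTo n f) (ℕ.*-suc p m)))
    (mod-+ (mod-trans (upto p′ ℕ.≤-refl) (contract (sumTo-contracts p q m) f h))
           (≡⇒mod (cong f (sym (ℕ.*-suc p m)))))
  where
  -- The p - 1 indices following p m are not multiples of p, so their terms vanish modulo `q`.
  upto : ∀ j → j ℕ.< p → sumTo (j ℕ.+ p ℕ.* m) f ≡ sumTo (p ℕ.* m) f [mod q ]
  upto zero _ = ≡⇒mod refl
  upto (suc j) j<p = mod-trans
    (mod-+ (upto j (ℕ.<-trans (ℕ.n<1+n j) j<p))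
       (∣⇒mod0 (h _ λ d → ℕ.<⇒≱ j<p (ℕ.∣⇒≤ (ℕ.∣m+n∣m⇒∣n (subst (p ℕ.∣_) (ℕ.+-comm _ (p ℕ.* m)) d) (ℕ.m∣m*n m))))))
    (≡⇒mod (ℤ.+-identityʳ _))

-- Sums over rows and 3×3 matrices

Row Mat : Set
Row = ℕ × ℕ × ℕ
Mat = Row × Row × Row

box : ℕ → Summation Row
box m = sumTo m ⊗ sumTo m ⊗ sumTo m

mat : ℕ → Summation Mat
mat m = box m ⊗ box m ⊗ box m

box-linear : ∀ m → Linear (box m)
box-linear m = ⊗-linear (sumTo-linear m) (⊗-linear (sumTo-linear m) (sumTo-linear m))

mat-linear : ∀ m → Linear (mat m)
mat-linear m = ⊗-linear (box-linear m) (⊗-linear (box-linear m) (box-linear m))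

commute-box : ∀ {I} {S : Summation I} → Linear S → ∀ m → Commute S (box m)
commute-box LS m = commute-⊗ (sumTo-linear m) (commute-sumTo LS m)
  (commute-⊗ (sumTo-linear m) (commute-sumTo LS m) (commute-sumTo LS m))

mat-rotate : ∀ m (f : Mat → ℤ) → mat m (λ (r , s , t) → f (s , t , r)) ≡ mat m f
mat-rotate m f = trans
  (swap (commute-box (box-linear m) m) λ r s → box m λ t → f (s , t , r))
  (ext (box-linear m) λ s → swap (commute-box (box-linear m) m) λ r t → f (s , t , r))

infix 4 _∣ᴿ_ _∣ᴹ_
infixr 7 _·ᴿ_ _·ᴹ_

_∣ᴿ_ : ℕ → Row → Set
d ∣ᴿ (a , b , c) = d ℕ.∣ a × d ℕ.∣ b × d ℕ.∣ c

_∣ᴹ_ : ℕ → Mat → Set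
d ∣ᴹ (r , s , t) = d ∣ᴿ r × d ∣ᴿ s × d ∣ᴿ t

_·ᴿ_ : ℕ → Row → Row
p ·ᴿ (a , b , c) = p ℕ.* a , p ℕ.* b , p ℕ.* c

_·ᴹ_ : ℕ → Mat → Mat
p ·ᴹ (r , s , t) = p ·ᴿ r , p ·ᴿ s , p ·ᴿ t

box-contracts : ∀ p q m → .{{ℕ.NonZero p}} → Contracts q (p ∣ᴿ_) (p ·ᴿ_) (box (p ℕ.* m)) (box m)
box-contracts p q m = ⊗-contracts (sumTo-linear m) (⊗-linear L L) c (⊗-contracts (sumTo-linear m) L c c)
  where
  L = sumTo-linear (p ℕ.* m)
  c = sumTo-contracts p q m

mat-contracts : ∀ p q m → .{{ℕ.NonZero p}} → Contracts q (p ∣ᴹ_) (p ·ᴹ_) (mat (p ℕ.* m)) (mat m)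
mat-contracts p q m = ⊗-contracts (box-linear m) (⊗-linear L L) c (⊗-contracts (box-linear m) L c c)
  where
  L = box-linear (p ℕ.* m)
  c = box-contracts p q m

-- Trinomial coefficients

afterPred : (ℕ → ℕ) → ℕ → ℕ
afterPred f zero    = 0
afterPred f (suc n) = f n

afterPred-cong : ∀ {f g} → (∀ n → f n ≡ g n) → ∀ n → afterPred f n ≡ afterPred g n
afterPred-cong h zero    = refl
afterPred-cong h (suc n) = h n

-- Pascal's rule instead of a quotient of factorials: the coefficient then makes sense, and is 0,
-- when a + b + c ≠ N, which confines sums over a box to the right row sums. The rule is also the
-- induction step of `shift-expand`.
trinomial : ℕ → ℕ → ℕ → ℕ → ℕ
trinomial zero zero zero zero = 1
trinomial zero _    _    _    = 0
trinomial (suc N) a b c =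
  afterPred (λ x → trinomial N x b c) a ℕ.+
  afterPred (λ y → trinomial N a y c) b ℕ.+
  afterPred (λ z → trinomial N a b z) c

trinomial-swap₁₂ : ∀ N a b c → trinomial N a b c ≡ trinomial N b a c
trinomial-swap₁₂ zero zero    zero    c       = refl
trinomial-swap₁₂ zero zero    (suc b) c       = refl
trinomial-swap₁₂ zero (suc a) zero    c       = refl
trinomial-swap₁₂ zero (suc a) (suc b) c       = refl
trinomial-swap₁₂ (suc N) a b c = cong₂ ℕ._+_
  (trans (ℕ.+-comm (afterPred _ a) _)
         (cong₂ ℕ._+_ (afterPred-cong (λ y → trinomial-swap₁₂ N a y c) b)
                    (afterPred-cong (λ x → trinomial-swap₁₂ N x b c) a)))
  (afterPred-cong (trinomial-swap₁₂ N a b) c)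

trinomial-swap₂₃ : ∀ N a b c → trinomial N a b c ≡ trinomial N a c b
trinomial-swap₂₃ zero zero    zero    zero    = refl
trinomial-swap₂₃ zero zero    zero    (suc c) = refl
trinomial-swap₂₃ zero zero    (suc b) zero    = refl
trinomial-swap₂₃ zero zero    (suc b) (suc c) = refl
trinomial-swap₂₃ zero (suc a) b       c       = refl
trinomial-swap₂₃ (suc N) a b c = trans
  (cong₂ ℕ._+_ (cong₂ ℕ._+_ (afterPred-cong (λ x → trinomial-swap₂₃ N x b c) a)
                        (afterPred-cong (λ y → trinomial-swap₂₃ N a y c) b))
             (afterPred-cong (λ z → trinomial-swap₂₃ N a b z) c))
  (lem (afterPred _ a) _ _)
  where
  lem : ∀ x y z → x ℕ.+ y ℕ.+ z ≡ x ℕ.+ z ℕ.+ y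
  lem = ℕ.solve-∀

trinomial≡0 : ∀ N a b c → a ℕ.+ b ℕ.+ c ≢ N → trinomial N a b c ≡ 0
trinomial≡0 zero zero    zero    zero    h = ⊥-elim (h refl)
trinomial≡0 zero zero    zero    (suc c) h = refl
trinomial≡0 zero zero    (suc b) c       h = refl
trinomial≡0 zero (suc a) b       c       h = refl
trinomial≡0 (suc N) a b c h = cong₂ ℕ._+_ (cong₂ ℕ._+_ (in-a a h) (in-b b h)) (in-c c h)
  where
  in-a : ∀ a → a ℕ.+ b ℕ.+ c ≢ suc N → afterPred (λ x → trinomial N x b c) a ≡ 0
  in-a zero    _ = refl
  in-a (suc a) h = trinomial≡0 N a b c (h ∘ cong suc)
  in-b : ∀ b → a ℕ.+ b ℕ.+ c ≢ suc N → afterPred (λ y → trinomial N a y c) b ≡ 0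
  in-b zero    _ = refl
  in-b (suc b) h = trinomial≡0 N a b c (h ∘ trans (cong (ℕ._+ c) (ℕ.+-suc a b)) ∘ cong suc)
  in-c : ∀ c → a ℕ.+ b ℕ.+ c ≢ suc N → afterPred (λ z → trinomial N a b z) c ≡ 0
  in-c zero    _ = refl
  in-c (suc c) h = trinomial≡0 N a b c (h ∘ trans (ℕ.+-suc (a ℕ.+ b) c) ∘ cong suc)

-- The three terms of Pascal's rule contribute a N!, b N! and c N!, which add up to (a + b + c) N!.
trinomial-! : ∀ N a b c → a ℕ.+ b ℕ.+ c ≡ N → trinomial N a b c ℕ.* (a ! ℕ.* b ! ℕ.* c !) ≡ N !
trinomial-! zero zero zero zero refl = refl
trinomial-! (suc N) a b c h = begin
  (X ℕ.+ Y ℕ.+ Z) ℕ.* (a ! ℕ.* b ! ℕ.* c !)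
    ≡⟨ distrib X Y Z _ ⟩
  X ℕ.* (a ! ℕ.* b ! ℕ.* c !) ℕ.+ Y ℕ.* (a ! ℕ.* b ! ℕ.* c !) ℕ.+ Z ℕ.* (a ! ℕ.* b ! ℕ.* c !)
    ≡⟨ cong₂ ℕ._+_ (cong₂ ℕ._+_ (in-a a h) (in-b b h)) (in-c c h) ⟩
  a ℕ.* N ! ℕ.+ b ℕ.* N ! ℕ.+ c ℕ.* N !
    ≡⟨ sym (distrib a b c (N !)) ⟩
  (a ℕ.+ b ℕ.+ c) ℕ.* N !
    ≡⟨ cong (ℕ._* N !) h ⟩
  suc N ℕ.* N ! ∎
  where
  open ≡-Reasoning
  X = afterPred (λ x → trinomial N x b c) a
  Y = afterPred (λ y → trinomial N a y c) b
  Z = afterPred (λ z → trinomial N a b z) c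
  distrib : ∀ x y z w → (x ℕ.+ y ℕ.+ z) ℕ.* w ≡ x ℕ.* w ℕ.+ y ℕ.* w ℕ.+ z ℕ.* w
  distrib = ℕ.solve-∀
  pull₁ : ∀ t n u v w → t ℕ.* (n ℕ.* u ℕ.* v ℕ.* w) ≡ n ℕ.* (t ℕ.* (u ℕ.* v ℕ.* w))
  pull₁ = ℕ.solve-∀
  pull₂ : ∀ t n u v w → t ℕ.* (u ℕ.* (n ℕ.* v) ℕ.* w) ≡ n ℕ.* (t ℕ.* (u ℕ.* v ℕ.* w))
  pull₂ = ℕ.solve-∀
  pull₃ : ∀ t n u v w → t ℕ.* (u ℕ.* v ℕ.* (n ℕ.* w)) ≡ n ℕ.* (t ℕ.* (u ℕ.* v ℕ.* w))
  pull₃ = ℕ.solve-∀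
  in-a : ∀ a → a ℕ.+ b ℕ.+ c ≡ suc N →
         afterPred (λ x → trinomial N x b c) a ℕ.* (a ! ℕ.* b ! ℕ.* c !) ≡ a ℕ.* N !
  in-a zero    _ = refl
  in-a (suc a) h = trans (pull₁ (trinomial N a b c) (suc a) (a !) (b !) (c !))
    (cong (suc a ℕ.*_) (trinomial-! N a b c (ℕ.suc-injective h)))
  in-b : ∀ b → a ℕ.+ b ℕ.+ c ≡ suc N →
         afterPred (λ y → trinomial N a y c) b ℕ.* (a ! ℕ.* b ! ℕ.* c !) ≡ b ℕ.* N !
  in-b zero    _ = refl
  in-b (suc b) h = trans (pull₂ (trinomial N a b c) (suc b) (a !) (b !) (c !))
    (cong (suc b ℕ.*_) (trinomial-! N a b c
      (ℕ.suc-injective (trans (sym (cong (ℕ._+ c) (ℕ.+-suc a b))) h))))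
  in-c : ∀ c → a ℕ.+ b ℕ.+ c ≡ suc N →
         afterPred (λ z → trinomial N a b z) c ℕ.* (a ! ℕ.* b ! ℕ.* c !) ≡ c ℕ.* N !
  in-c zero    _ = refl
  in-c (suc c) h = trans (pull₃ (trinomial N a b c) (suc c) (a !) (b !) (c !))
    (cong (suc c ℕ.*_) (trinomial-! N a b c (ℕ.suc-injective (trans (sym (ℕ.+-suc (a ℕ.+ b) c)) h))))

factorials≢0 : ∀ a b c → ℕ.NonZero (a ! ℕ.* b ! ℕ.* c !)
factorials≢0 a b c = ℕ.m*n≢0 (a ! ℕ.* b !) (c !) {{a ℕ.!* b !≢0}} {{c ℕ.!≢0}}

-- Cancelling a against a! and pulling N out of N! leaves a coefficient of degree N - 1. The purpose
-- is that N divides a times the coefficient.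
trinomial-absorb : ∀ N a b c → a ℕ.* trinomial N a b c ≡ N ℕ.* afterPred (λ x → trinomial (ℕ.pred N) x b c) a
trinomial-absorb N zero b c = sym (ℕ.*-zeroʳ N)
trinomial-absorb zero (suc a) b c = ℕ.*-zeroʳ a
trinomial-absorb (suc N) (suc a) b c with suc a ℕ.+ b ℕ.+ c ℕ.≟ suc N
... | no  h = trans (cong (suc a ℕ.*_) (trinomial≡0 (suc N) (suc a) b c h))
  (trans (ℕ.*-zeroʳ (suc a)) (sym (trans (cong (suc N ℕ.*_) (trinomial≡0 N a b c (h ∘ cong suc))) (ℕ.*-zeroʳ (suc N)))))
... | yes h = ℕ.*-cancelʳ-≡ _ _ (a ! ℕ.* b ! ℕ.* c !) {{factorials≢0 a b c}} (begin
  suc a ℕ.* t ℕ.* (a ! ℕ.* b ! ℕ.* c !)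
    ≡⟨ lem₁ (suc a) t (a !) (b !) (c !) ⟩
  t ℕ.* (suc a ! ℕ.* b ! ℕ.* c !)
    ≡⟨ trinomial-! (suc N) (suc a) b c h ⟩
  suc N ℕ.* N !
    ≡⟨ cong (suc N ℕ.*_) (sym (trinomial-! N a b c (ℕ.suc-injective h))) ⟩
  suc N ℕ.* (trinomial N a b c ℕ.* (a ! ℕ.* b ! ℕ.* c !))
    ≡⟨ sym (ℕ.*-assoc (suc N) (trinomial N a b c) _) ⟩
  suc N ℕ.* trinomial N a b c ℕ.* (a ! ℕ.* b ! ℕ.* c !) ∎)
  where
  open ≡-Reasoning
  t = trinomial (suc N) (suc a) b c
  lem₁ : ∀ n t u v w → n ℕ.* t ℕ.* (u ℕ.* v ℕ.* w) ≡ t ℕ.* (n ℕ.* u ℕ.* v ℕ.* w)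
  lem₁ = ℕ.solve-∀

∣trinomial₁ : ∀ N a b c → N ℕ.∣ a ℕ.* trinomial N a b c
∣trinomial₁ N a b c = subst (N ℕ.∣_) (sym (trinomial-absorb N a b c)) (ℕ.m∣m*n _)

∣trinomial₂ : ∀ N a b c → N ℕ.∣ b ℕ.* trinomial N a b c
∣trinomial₂ N a b c = subst (λ t → N ℕ.∣ b ℕ.* t) (trinomial-swap₁₂ N b a c) (∣trinomial₁ N b a c)

∣trinomial₃ : ∀ N a b c → N ℕ.∣ c ℕ.* trinomial N a b c
∣trinomial₃ N a b c = subst (λ t → N ℕ.∣ c ℕ.* t) (trinomial-swap₂₃ N a c b) (∣trinomial₂ N a c b)

-- Valuations add: if `a` has valuation at most e, then `t` has at least j. Euclid's lemma takes one
-- factor p at a time from `a`, lowering e, or from `t`, lowering j.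
prime-power-split : ∀ {p} → Prime p → ∀ e j {a t} → p ^ (e ℕ.+ j) ℕ.∣ a ℕ.* t → p ^ suc e ℕ.∣ a ⊎ p ^ j ℕ.∣ t
prime-power-split pp e zero h = inj₂ (ℕ.1∣ _)
prime-power-split {p} pp e (suc j) {a} {t} h
  with euclidsLemma a t pp (ℕ.∣-trans (subst (λ n → p ℕ.∣ p ^ n) (sym (ℕ.+-suc e j)) (ℕ.m∣m*n (p ^ (e ℕ.+ j)))) h)
... | inj₂ (ℕ.divides t′ refl)
  with prime-power-split pp e j {a} {t′}
         (ℕ.*-cancelˡ-∣ p {{prime⇒nonZero pp}} (subst₂ ℕ._∣_ (cong (p ^_) (ℕ.+-suc e j)) (lem a t′ p) h))
  where
  lem : ∀ a t p → a ℕ.* (t ℕ.* p) ≡ p ℕ.* (a ℕ.* t)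
  lem = ℕ.solve-∀
... | inj₁ d = inj₁ d
... | inj₂ d = inj₂ (subst (p ℕ.* p ^ j ℕ.∣_) (ℕ.*-comm p t′) (ℕ.*-monoʳ-∣ p d))
prime-power-split {p} pp zero (suc j) {a} {t} h | inj₁ d = inj₁ (subst (ℕ._∣ a) (sym (ℕ.*-identityʳ p)) d)
prime-power-split {p} pp (suc e) (suc j) {a} {t} h | inj₁ (ℕ.divides a′ refl)
  with prime-power-split pp e (suc j) {a′} {t}
         (ℕ.*-cancelˡ-∣ p {{prime⇒nonZero pp}} (subst (p ^ (suc e ℕ.+ suc j) ℕ.∣_) (lem a′ t p) h))
  where
  lem : ∀ a t p → a ℕ.* p ℕ.* t ≡ p ℕ.* (a ℕ.* t)
  lem = ℕ.solve-∀
... | inj₁ d = inj₁ (subst (p ℕ.* p ^ suc e ℕ.∣_) (ℕ.*-comm p a′) (ℕ.*-monoʳ-∣ p d))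
... | inj₂ d = inj₂ d

-- The products of the residues prime to p

pos-∣ : ∀ {m n} → m ℕ.∣ n → + m ∣ + n
pos-∣ = ∣ᵤ⇒∣

pos-∣⁻ : ∀ {m n} → + m ∣ + n → m ℕ.∣ n
pos-∣⁻ = ∣⇒∣ᵤ

*-pres-∣ : ∀ {a b c d} → a ∣ b → c ∣ d → a * c ∣ b * d
*-pres-∣ {a} {c = c} (divides q refl) (divides r refl) = divides (q * r) (lem q a r c)
  where
  lem : ∀ q a r c → (q * a) * (r * c) ≡ (q * r) * (a * c)
  lem = solve-∀

euclidℤ : ∀ {p} → Prime p → ∀ x y → + p ∣ x * y → + p ∣ x ⊎ + p ∣ y
euclidℤ {p} pp x y d
  with euclidsLemma ℤ.∣ x ∣ ℤ.∣ y ∣ pp (subst (p ℕ.∣_) (ℤ.abs-* x y) (∣⇒∣ᵤ d))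
... | inj₁ e = inj₁ (∣ᵤ⇒∣ e)
... | inj₂ e = inj₂ (∣ᵤ⇒∣ e)

prime-power-cancel : ∀ {p} → Prime p → ∀ j {x y} → ¬ + p ∣ x → + (p ^ j) ∣ x * y → + (p ^ j) ∣ y
prime-power-cancel {p} pp j {x} {y} p∤x d
  with prime-power-split pp 0 j (subst (p ^ j ℕ.∣_) (ℤ.abs-* x y) (∣⇒∣ᵤ d))
... | inj₁ e = ⊥-elim (p∤x (∣ᵤ⇒∣ (subst (ℕ._∣ ℤ.∣ x ∣) (ℕ.*-identityʳ p) e)))
... | inj₂ e = ∣ᵤ⇒∣ e

-- The product (x + 1)⋯(x + n). It starts at x + 1 so that, for p dividing x and n = p - 1, it is a
-- block of consecutive integers prime to p.
rising : ℤ → ℕ → ℤ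
rising x zero    = 1ℤ
rising x (suc n) = rising x n * (x + + suc n)

rising-suc : ∀ x n → rising x (suc n) ≡ (x + 1ℤ) * rising (x + 1ℤ) n
rising-suc x zero = ℤ.*-comm 1ℤ (x + 1ℤ)
rising-suc x (suc n) = trans (cong (_* (x + + suc (suc n))) (rising-suc x n))
  (lem x (+ suc n) (rising (x + 1ℤ) n))
  where
  lem : ∀ x k r → ((x + 1ℤ) * r) * (x + (1ℤ + k)) ≡ (x + 1ℤ) * (r * ((x + 1ℤ) + k))
  lem = solve-∀

-- The reflection reverses the order of the n factors and negates each of them.
rising-reflect : ∀ x n → rising (- x - + suc n) n ≡ sign n * rising x n
rising-reflect x zero = refl
rising-reflect x (suc n) = begin
  rising (- x - + suc (suc n)) n * (- x - + suc (suc n) + + suc n)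
    ≡⟨ cong₂ (λ y z → rising y n * z) (lem₁ x (+ suc n)) (lem₂ x (+ suc n)) ⟩
  rising (- (x + 1ℤ) - + suc n) n * (- (x + 1ℤ))
    ≡⟨ cong (_* (- (x + 1ℤ))) (rising-reflect (x + 1ℤ) n) ⟩
  sign n * rising (x + 1ℤ) n * (- (x + 1ℤ))
    ≡⟨ lem₃ (sign n) (x + 1ℤ) (rising (x + 1ℤ) n) ⟩
  - sign n * ((x + 1ℤ) * rising (x + 1ℤ) n)
    ≡⟨ cong (- sign n *_) (sym (rising-suc x n)) ⟩
  - sign n * rising x (suc n) ∎
  where
  open ≡-Reasoning
  lem₁ : ∀ x k → - x - (1ℤ + k) ≡ - (x + 1ℤ) - k
  lem₁ = solve-∀
  lem₂ : ∀ x k → - x - (1ℤ + k) + k ≡ - (x + 1ℤ)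
  lem₂ = solve-∀
  lem₃ : ∀ s y r → s * r * (- y) ≡ - s * (y * r)
  lem₃ = solve-∀

-- The quadratics (T + A)(T + A′) and (T + D)(T + D′) agree modulo m at every T, so products over a
-- range of T can be compared factor by factor.
record SamePoly (m A A′ D D′ : ℤ) : Set where
  field
    sum≡ : A + A′ ≡ D + D′
    prod≡ : A * A′ ≡ D * D′ [mod m ]
open SamePoly

SamePoly-shift : ∀ {m A A′ D D′} k → SamePoly m A A′ D D′ → SamePoly m (A + k) (A′ + k) (D + k) (D′ + k)
SamePoly-shift {m} {A} {A′} {D} {D′} k s = record
  { sum≡ = trans (lem₁ A A′ k) (trans (cong (_+ (k + k)) (sum≡ s)) (sym (lem₁ D D′ k)))
  ; prod≡ = mod-trans (≡⇒mod (lem₂ A A′ k))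
      (mod-trans (mod-+ (prod≡ s) (≡⇒mod (cong (λ z → k * z + k * k) (sum≡ s))))
                 (≡⇒mod (sym (lem₂ D D′ k)))) }
  where
  lem₁ : ∀ a a′ k → (a + k) + (a′ + k) ≡ (a + a′) + (k + k)
  lem₁ = solve-∀
  lem₂ : ∀ a a′ k → (a + k) * (a′ + k) ≡ a * a′ + (k * (a + a′) + k * k)
  lem₂ = solve-∀

*-interchange : ∀ a b c d → (a * b) * (c * d) ≡ (a * c) * (b * d)
*-interchange = solve-∀

rising-pair : ∀ {m A A′ D D′} → SamePoly m A A′ D D′ → ∀ n →
  rising A n * rising A′ n ≡ rising D n * rising D′ n [mod m ]
rising-pair s zero = ≡⇒mod refl
rising-pair {A = A} {A′} {D} {D′} s (suc n) =
  mod-trans (≡⇒mod (*-interchange (rising A n) _ (rising A′ n) _))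
    (mod-trans (mod-* (rising-pair s n) (prod≡ (SamePoly-shift (+ suc n) s)))
      (≡⇒mod (*-interchange (rising D n) (rising D′ n) _ _)))

rising-mod : ∀ {m A D} → A ≡ D [mod m ] → ∀ n → rising A n ≡ rising D n [mod m ]
rising-mod s zero = ≡⇒mod refl
rising-mod s (suc n) = mod-* (rising-mod s n) (mod-+ s (≡⇒mod refl))

module _ (q : ℕ) where
  private
    p : ℕ
    p = suc q
    P : ℤ
    P = + p

  -- The product of x + s over the s < p b prime to p, where p = 1 + q.
  unitProd : ℤ → ℕ → ℤ
  unitProd x zero    = 1ℤ
  unitProd x (suc b) = unitProd x b * rising (x + P * + b) q

  unitProd-suc : ∀ x b → unitProd x (suc b) ≡ rising x q * unitProd (x + P) b
  unitProd-suc x zero = trans (ℤ.*-comm 1ℤ _)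
    (cong (λ y → rising y q * 1ℤ) (trans (cong (_+_ x) (ℤ.*-zeroʳ P)) (ℤ.+-identityʳ x)))
  unitProd-suc x (suc b) = trans
    (cong₂ (λ u y → u * rising y q) (unitProd-suc x b) (lem x P (+ b)))
    (ℤ.*-assoc (rising x q) (unitProd (x + P) b) _)
    where
    lem : ∀ x p b → x + p * (1ℤ + b) ≡ x + p + p * b
    lem = solve-∀

  unitProd-+ : ∀ a b → unitProd 0ℤ (b ℕ.+ a) ≡ unitProd 0ℤ a * unitProd (P * + a) b
  unitProd-+ a zero = sym (ℤ.*-identityʳ _)
  unitProd-+ a (suc b) = trans
    (cong₂ (λ u y → u * rising y q) (unitProd-+ a b) (lem P (+ b) (+ a)))
    (ℤ.*-assoc (unitProd 0ℤ a) (unitProd (P * + a) b) _)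
    where
    lem : ∀ p b a → 0ℤ + p * (b + a) ≡ p * a + p * b
    lem = solve-∀

  unitProd-pair : ∀ {m A A′ D D′} → SamePoly m A A′ D D′ → ∀ b →
    unitProd A b * unitProd A′ b ≡ unitProd D b * unitProd D′ b [mod m ]
  unitProd-pair s zero = ≡⇒mod refl
  unitProd-pair {A = A} {A′} {D} {D′} s (suc b) =
    mod-trans (≡⇒mod (*-interchange (unitProd A b) _ (unitProd A′ b) _))
      (mod-trans (mod-* (unitProd-pair s b) (rising-pair (SamePoly-shift (P * + b) s) q))
        (≡⇒mod (*-interchange (unitProd D b) (unitProd D′ b) _ _)))

  unitProd-mod : ∀ {m A D} → A ≡ D [mod m ] → ∀ b → unitProd A b ≡ unitProd D b [mod m ]
  unitProd-mod s zero = ≡⇒mod refl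
  unitProd-mod s (suc b) = mod-* (unitProd-mod s b) (rising-mod (mod-+ s (≡⇒mod refl)) q)

  -- The s < p b prime to p are permuted by s ↦ p b - s. Each block has q = p - 1 factors, an even
  -- number, so the signs cancel.
  unitProd-reflect : sign q ≡ 1ℤ → ∀ x b → unitProd (- x - P * + b) b ≡ unitProd x b
  unitProd-reflect sq x zero = refl
  unitProd-reflect sq x (suc b) = begin
    unitProd (- x - P * + suc b) b * rising (- x - P * + suc b + P * + b) q
      ≡⟨ cong₂ (λ y z → unitProd y b * rising z q) (lem₁ x P (+ b)) (lem₂ x P (+ b)) ⟩
    unitProd (- (x + P) - P * + b) b * rising (- x - P) q
      ≡⟨ cong₂ _*_ (unitProd-reflect sq (x + P) b) (rising-reflect x q) ⟩
    unitProd (x + P) b * (sign q * rising x q)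
      ≡⟨ cong (λ s → unitProd (x + P) b * (s * rising x q)) sq ⟩
    unitProd (x + P) b * (1ℤ * rising x q)
      ≡⟨ lem₃ (unitProd (x + P) b) (rising x q) ⟩
    rising x q * unitProd (x + P) b
      ≡⟨ sym (unitProd-suc x b) ⟩
    unitProd x (suc b) ∎
    where
    open ≡-Reasoning
    lem₁ : ∀ x p b → - x - p * (1ℤ + b) ≡ - (x + p) - p * b
    lem₁ = solve-∀
    lem₂ : ∀ x p b → - x - p * (1ℤ + b) + p * b ≡ - x - p
    lem₂ = solve-∀
    lem₃ : ∀ u r → u * (1ℤ * r) ≡ r * u
    lem₃ = solve-∀

  rising-! : ∀ x n → + ((n ℕ.+ x) !) ≡ + (x !) * rising (+ x) n
  rising-! x zero = sym (ℤ.*-identityʳ _)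
  rising-! x (suc n) = begin
    + (suc (n ℕ.+ x) ℕ.* (n ℕ.+ x) !)
      ≡⟨ ℤ.pos-* (suc (n ℕ.+ x)) ((n ℕ.+ x) !) ⟩
    (+ suc n + + x) * + ((n ℕ.+ x) !)
      ≡⟨ cong ((+ suc n + + x) *_) (rising-! x n) ⟩
    (+ suc n + + x) * (+ (x !) * rising (+ x) n)
      ≡⟨ lem (+ suc n) (+ x) (+ (x !)) (rising (+ x) n) ⟩
    + (x !) * (rising (+ x) n * (+ x + + suc n)) ∎
    where
    open ≡-Reasoning
    lem : ∀ n x f r → (n + x) * (f * r) ≡ f * (r * (x + n))
    lem = solve-∀

  -- Among 1, ..., p n the multiples of p contribute p^n n!, the other factors `unitProd`.
  unitProd-! : ∀ n → + ((p ℕ.* n) !) ≡ + (p ^ n) * + (n !) * unitProd 0ℤ n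
  unitProd-! zero = cong (λ m → + (m !)) (ℕ.*-zeroʳ q)
  unitProd-! (suc n) = begin
    + ((p ℕ.* suc n) !)
      ≡⟨ cong (λ m → + (m !)) (ℕ.*-suc p n) ⟩
    + (suc (q ℕ.+ p ℕ.* n) ℕ.* (q ℕ.+ p ℕ.* n) !)
      ≡⟨ ℤ.pos-* (suc (q ℕ.+ p ℕ.* n)) _ ⟩
    + suc (q ℕ.+ p ℕ.* n) * + ((q ℕ.+ p ℕ.* n) !)
      ≡⟨ cong₂ _*_ (trans (cong (λ m → + m) (sym (ℕ.*-suc p n))) (ℤ.pos-* p (suc n)))
                   (rising-! (p ℕ.* n) q) ⟩
    P * + suc n * (+ ((p ℕ.* n) !) * rising (+ (p ℕ.* n)) q)
      ≡⟨ cong₂ (λ u y → P * + suc n * (u * rising y q)) (unitProd-! n)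
               (trans (ℤ.pos-* p n) (sym (ℤ.+-identityˡ _))) ⟩
    P * + suc n * (+ (p ^ n) * + (n !) * unitProd 0ℤ n * rising (0ℤ + P * + n) q)
      ≡⟨ lem P (+ suc n) (+ (p ^ n)) (+ (n !)) (unitProd 0ℤ n) _ ⟩
    (P * + (p ^ n)) * (+ suc n * + (n !)) * (unitProd 0ℤ n * rising (0ℤ + P * + n) q)
      ≡⟨ cong₂ (λ x y → x * y * unitProd 0ℤ (suc n))
               (sym (ℤ.pos-* p (p ^ n))) (sym (ℤ.pos-* (suc n) (n !))) ⟩
    + (p ^ suc n) * + (suc n !) * unitProd 0ℤ (suc n) ∎
    where
    open ≡-Reasoning
    lem : ∀ p m a f u r → p * m * (a * f * u * r) ≡ (p * a) * (m * f) * (u * r)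
    lem = solve-∀

  module _ (pp : Prime p) where

    unitProd-coprime : ∀ b → ¬ P ∣ unitProd 0ℤ b
    unitProd-coprime zero d = ℕ.>⇒∤ (ℕ.nonTrivial⇒n>1 p {{prime⇒nonTrivial pp}}) (pos-∣⁻ d)
    unitProd-coprime (suc b) d with euclidℤ pp (unitProd 0ℤ b) _ d
    ... | inj₁ e = unitProd-coprime b e
    ... | inj₂ e = in-rising q ℕ.≤-refl e
      where
      in-rising : ∀ n → n ℕ.≤ q → ¬ P ∣ rising (0ℤ + P * + b) n
      in-rising zero _ d = unitProd-coprime zero d
      in-rising (suc n) n<q d with euclidℤ pp (rising (0ℤ + P * + b) n) _ d
      ... | inj₁ e = in-rising n (ℕ.<⇒≤ n<q) e
      ... | inj₂ e = ℕ.>⇒∤ (s≤s n<q) (pos-∣⁻ (∣m+n∣m⇒∣n e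
              (subst (P ∣_) (sym (ℤ.+-identityˡ _)) (∣m⇒∣m*n (+ b) ∣-refl))))

    odd⇒∤2 : sign q ≡ 1ℤ → ¬ P ∣ + 2
    odd⇒∤2 sq d = p≢2 q sq (ℕ.∣⇒≤ (pos-∣⁻ d)) (ℕ.nonTrivial⇒n>1 p {{prime⇒nonTrivial pp}})
      where
      p≢2 : ∀ q → sign q ≡ 1ℤ → suc q ℕ.≤ 2 → ¬ 2 ℕ.≤ suc q
      p≢2 zero _ _ (s≤s ())
      p≢2 (suc zero) () _ _
      p≢2 (suc (suc q)) _ (s≤s (s≤s ())) _

    -- Reflection s ↦ p b − s shows that the values of f(X) = unitProd X b satisfy f(X)² ≡ f(0)².
    unitProd-cong : sign q ≡ 1ℤ → ∀ e {X} b → + (p ^ suc e) ∣ X → + (p ^ suc e) ∣ P * + b →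
      unitProd X b ≡ unitProd 0ℤ b [mod + (p ^ (suc e ℕ.+ suc e)) ]
    unitProd-cong sq e {X} b dX db = mod (prime-power-cancel pp (suc e ℕ.+ suc e) p∤f+f₀
      (subst₂ _∣_ (sym Y²) (lem₁ f f₀) (diff squares)))
      where
      Y = + (p ^ suc e)
      f = unitProd X b
      f₀ = unitProd 0ℤ b
      Y² : + (p ^ (suc e ℕ.+ suc e)) ≡ Y * Y
      Y² = trans (cong +_ (ℕ.^-distribˡ-+-* p (suc e) (suc e))) (ℤ.pos-* (p ^ suc e) (p ^ suc e))
      lem₁ : ∀ x y → x * x - y * y ≡ (x + y) * (x - y)
      lem₁ = solve-∀
      lem₂ : ∀ x y → x + (- x - y) ≡ 0ℤ + (- 0ℤ - y)
      lem₂ = solve-∀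
      lem₃ : ∀ x y → (x + y) - (x - y) ≡ + 2 * y
      lem₃ = solve-∀
      -- The pairs X, -X - p b and 0, -p b have the same sum. The product of the first is divisible
      -- by Y², since X and p b are divisible by Y; that of the second is 0.
      squares : f * f ≡ f₀ * f₀ [mod Y * Y ]
      squares = mod-trans (≡⇒mod (cong (f *_) (sym (unitProd-reflect sq X b))))
        (mod-trans (unitProd-pair record
            { sum≡ = lem₂ X (P * + b)
            ; prod≡ = ∣⇒mod0 (*-pres-∣ dX (∣m∣n⇒∣m-n (∣m⇒∣-m dX) db)) } b)
          (≡⇒mod (cong (f₀ *_) (unitProd-reflect sq 0ℤ b))))
      P∣Y : P ∣ Y
      P∣Y = pos-∣ (ℕ.m∣m*n (p ^ e))
      -- Modulo p, f ≡ f₀, hence f + f₀ ≡ 2 f₀, which is prime to the odd prime p. So f + f₀ may be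
      -- cancelled from f² - f₀².
      p∤f+f₀ : ¬ P ∣ f + f₀
      p∤f+f₀ d with euclidℤ pp (+ 2) f₀ (subst (P ∣_) (lem₃ f f₀)
        (∣m∣n⇒∣m-n d (diff (unitProd-mod (∣⇒mod0 (∣-trans P∣Y dX)) b))))
      ... | inj₂ d′ = unitProd-coprime b d′
      ... | inj₁ d′ = odd⇒∤2 sq d′

    -- Jacobsthal's congruence without denominators. The factors beyond p a are a translate by p a
    -- of the first ones, and p a has one factor p more than a, which accounts for `suc e`.
    unitProd-+-cong : sign q ≡ 1ℤ → ∀ e {a b} → p ^ e ℕ.∣ a → p ^ e ℕ.∣ b →
      unitProd 0ℤ (b ℕ.+ a) ≡ unitProd 0ℤ b * unitProd 0ℤ a [mod + (p ^ (suc e ℕ.+ suc e)) ]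
    unitProd-+-cong sq e {a} {b} da db = mod-trans (≡⇒mod (trans (unitProd-+ a b) (ℤ.*-comm (unitProd 0ℤ a) _)))
      (mod-* (unitProd-cong sq e b (times da) (times db)) (≡⇒mod refl))
      where
      times : ∀ {n} → p ^ e ℕ.∣ n → + (p ^ suc e) ∣ P * + n
      times {n} d = subst (+ (p ^ suc e) ∣_) (ℤ.pos-* p n) (pos-∣ (ℕ.*-monoʳ-∣ p d))

-- Weights of matrices

pos-*³ : ∀ x y z → + (x ℕ.* y ℕ.* z) ≡ + x * + y * + z
pos-*³ x y z = trans (ℤ.pos-* (x ℕ.* y) z) (cong (_* + z) (ℤ.pos-* x y))

rowSum : Row → ℕ
rowSum (a , b , c) = a ℕ.+ b ℕ.+ c

columnSums : Mat → Row
columnSums ((a , b , c) , (a′ , b′ , c′) , (a″ , b″ , c″)) =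
  a ℕ.+ a′ ℕ.+ a″ , b ℕ.+ b′ ℕ.+ b″ , c ℕ.+ c′ ℕ.+ c″

coeff : ℕ → Row → ℕ
coeff N (a , b , c) = trinomial N a b c

coeff≡0 : ∀ N r → rowSum r ≢ N → coeff N r ≡ 0
coeff≡0 N (a , b , c) = trinomial≡0 N a b c

weight : ℕ → Mat → ℕ
weight N (r , s , t) = coeff N r ℕ.* coeff N s ℕ.* coeff N t

record Magic (N : ℕ) (m : Mat) : Set where
  field
    row₁ : rowSum (proj₁ m) ≡ N
    row₂ : rowSum (proj₁ (proj₂ m)) ≡ N
    row₃ : rowSum (proj₂ (proj₂ m)) ≡ N
    columns : columnSums m ≡ (N , N , N)
open Magic

rowSum-·ᴿ : ∀ p r → rowSum (p ·ᴿ r) ≡ p ℕ.* rowSum r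
rowSum-·ᴿ p (a , b , c) = sym (trans (ℕ.*-distribˡ-+ p (a ℕ.+ b) c) (cong (ℕ._+ p ℕ.* c) (ℕ.*-distribˡ-+ p a b)))

third-row : ∀ {N d m} → Magic N m → d ℕ.∣ N → d ∣ᴿ proj₁ m → d ∣ᴿ proj₁ (proj₂ m) → d ∣ᴿ proj₂ (proj₂ m)
third-row {N} {d} m d∣N (a , b , c) (a′ , b′ , c′) =
  entry (cong proj₁ (columns m)) a a′ ,
  entry (cong (proj₁ ∘ proj₂) (columns m)) b b′ ,
  entry (cong (proj₂ ∘ proj₂) (columns m)) c c′
  where
  entry : ∀ {x y z} → x ℕ.+ y ℕ.+ z ≡ N → d ℕ.∣ x → d ℕ.∣ y → d ℕ.∣ z
  entry h dx dy = ℕ.∣m+n∣m⇒∣n (subst (d ℕ.∣_) (sym h) d∣N) (ℕ.∣m∣n⇒∣m+n dx dy)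

Magic-rotate : ∀ {N r s t} → Magic N (r , s , t) → Magic N (s , t , r)
Magic-rotate {N} {a , b , c} {a′ , b′ , c′} {a″ , b″ , c″} m = record
  { row₁ = row₂ m ; row₂ = row₃ m ; row₃ = row₁ m
  ; columns = trans (cong₂ _,_ (lem a′ a″ a) (cong₂ _,_ (lem b′ b″ b) (lem c′ c″ c))) (columns m) }
  where
  lem : ∀ x y z → x ℕ.+ y ℕ.+ z ≡ z ℕ.+ x ℕ.+ y
  lem = ℕ.solve-∀

module _ {p : ℕ} (pp : Prime p) where

  -- N divides each entry times the coefficient, so a single entry of valuation at most e already
  -- forces p^j into the coefficient.
  row-split : ∀ {N} e j → p ^ (e ℕ.+ j) ℕ.∣ N → ∀ r → p ^ suc e ∣ᴿ r ⊎ p ^ j ℕ.∣ coeff N r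
  row-split {N} e j d (a , b , c)
    with prime-power-split pp e j {a} (ℕ.∣-trans d (∣trinomial₁ N a b c))
       | prime-power-split pp e j {b} (ℕ.∣-trans d (∣trinomial₂ N a b c))
       | prime-power-split pp e j {c} (ℕ.∣-trans d (∣trinomial₃ N a b c))
  ... | inj₂ h | _ | _ = inj₂ h
  ... | inj₁ _ | inj₂ h | _ = inj₂ h
  ... | inj₁ _ | inj₁ _ | inj₂ h = inj₂ h
  ... | inj₁ x | inj₁ y | inj₁ z = inj₁ (x , y , z)

  power∣ : ∀ {N} e j → p ^ (e ℕ.+ suc j) ℕ.∣ N → p ^ suc e ℕ.∣ N
  power∣ e j = ℕ.∣-trans (subst (λ n → p ^ suc e ℕ.∣ p ^ n) (sym (ℕ.+-suc e j))
    (subst (p ^ suc e ℕ.∣_) (sym (ℕ.^-distribˡ-+-* p (suc e) j)) (ℕ.m∣m*n (p ^ j))))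

  -- The minimal p-adic valuation of the entries is attained in at least two rows,
  -- since the column sums are N.
  magic-split : ∀ {N m} e j → Magic N m → p ^ (e ℕ.+ suc j) ℕ.∣ N →
    p ^ suc e ∣ᴹ m ⊎ p ^ (suc j ℕ.+ suc j) ℕ.∣ weight N m
  magic-split {N} {r , s , t} e j m d
    with row-split e (suc j) d r | row-split e (suc j) d s | row-split e (suc j) d t
  ... | inj₁ x | inj₁ y | _ = inj₁ (x , y , third-row m (power∣ e j d) x y)
  ... | inj₁ x | inj₂ _ | inj₁ z = inj₁ (x , third-row (Magic-rotate (Magic-rotate m)) (power∣ e j d) z x , z)
  ... | inj₂ _ | inj₁ y | inj₁ z = inj₁ (third-row (Magic-rotate m) (power∣ e j d) y z , y , z)
  ... | inj₂ x | inj₂ y | _ = inj₂ (subst (ℕ._∣ weight N (r , s , t)) (sym (ℕ.^-distribˡ-+-* p (suc j) (suc j)))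
    (ℕ.∣m⇒∣m*n _ (ℕ.*-pres-∣ x y)))
  ... | inj₂ x | inj₁ _ | inj₂ z = inj₂ (subst₂ ℕ._∣_ (sym (ℕ.^-distribˡ-+-* p (suc j) (suc j)))
    (lem (coeff N r) (coeff N s) (coeff N t)) (ℕ.∣m⇒∣m*n (coeff N s) (ℕ.*-pres-∣ x z)))
    where
    lem : ∀ x y z → x ℕ.* z ℕ.* y ≡ x ℕ.* y ℕ.* z
    lem = ℕ.solve-∀
  ... | inj₁ _ | inj₂ y | inj₂ z = inj₂ (subst₂ ℕ._∣_ (sym (ℕ.^-distribˡ-+-* p (suc j) (suc j)))
    (lem (coeff N r) (coeff N s) (coeff N t)) (ℕ.∣m⇒∣m*n (coeff N r) (ℕ.*-pres-∣ y z)))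
    where
    lem : ∀ x y z → y ℕ.* z ℕ.* x ≡ x ℕ.* y ℕ.* z
    lem = ℕ.solve-∀

  ∣weight : ∀ {N m} k → Magic N m → p ^ k ℕ.∣ N → ¬ p ∣ᴹ m → p ^ (k ℕ.+ k) ℕ.∣ weight N m
  ∣weight zero m d h = ℕ.1∣ _
  ∣weight (suc k) m d h with magic-split 0 k m d
  ... | inj₂ e = e
  ... | inj₁ e = ⊥-elim (h (subst (_∣ᴹ _) (ℕ.*-identityʳ p) e))

module _ {q : ℕ} (pp : Prime (suc q)) (sq : sign q ≡ 1ℤ) where
  private
    p : ℕ
    p = suc q
    U : ℕ → ℤ
    U = unitProd q 0ℤ

  unitRow : Row → ℤ
  unitRow (a , b , c) = U a * U b * U c

  unitRow-coprime : ∀ r → ¬ + p ∣ unitRow r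
  unitRow-coprime (a , b , c) d with euclidℤ pp (U a * U b) (U c) d
  ... | inj₂ e = unitProd-coprime q pp c e
  ... | inj₁ e with euclidℤ pp (U a) (U b) e
  ...   | inj₁ e′ = unitProd-coprime q pp a e′
  ...   | inj₂ e′ = unitProd-coprime q pp b e′

  unitRow-cong : ∀ e r → p ^ e ∣ᴿ r → U (rowSum r) ≡ unitRow r [mod + (p ^ (suc e ℕ.+ suc e)) ]
  unitRow-cong e (a , b , c) (da , db , dc) =
    mod-trans (unitProd-+-cong q pp sq e dc (ℕ.∣m∣n⇒∣m+n da db))
      (mod-* (unitProd-+-cong q pp sq e db da) (≡⇒mod refl))

  -- Write every factorial (p n)! as p^n n! U(n). The powers of p cancel because a + b + c = N, and
  -- what remains is stated without division. If the row sum is wrong, both coefficients are 0.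
  coeff-·ᴿ : ∀ N r → + coeff (p ℕ.* N) (p ·ᴿ r) * unitRow r ≡ + coeff N r * U N
  coeff-·ᴿ N r@(a , b , c) with rowSum r ℕ.≟ N
  ... | no h = trans (cong (λ t → + t * unitRow r)
                  (coeff≡0 (p ℕ.* N) (p ·ᴿ r) λ e → h (ℕ.*-cancelˡ-≡ _ _ p (trans (sym (rowSum-·ᴿ p r)) e))))
                 (sym (cong (λ t → + t * U N) (coeff≡0 N r h)))
  ... | yes h = ℤ.*-cancelʳ-≡ _ _ (+ D) {{D≢0}} (begin
    + T′ * (U a * U b * U c) * + D
      ≡⟨ cong (+ T′ * (U a * U b * U c) *_) D-split ⟩
    + T′ * (U a * U b * U c) * ((A * B′ * C′) * (A! * B! * C!))
      ≡⟨ lem₁ (+ T′) A B′ C′ A! B! C! (U a) (U b) (U c) ⟩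
    + T′ * ((A * A! * U a) * (B′ * B! * U b) * (C′ * C! * U c))
      ≡⟨ cong (+ T′ *_) (sym fact³) ⟩
    + T′ * + ((p ℕ.* a) ! ℕ.* (p ℕ.* b) ! ℕ.* (p ℕ.* c) !)
      ≡⟨ sym (ℤ.pos-* T′ _) ⟩
    + (T′ ℕ.* ((p ℕ.* a) ! ℕ.* (p ℕ.* b) ! ℕ.* (p ℕ.* c) !))
      ≡⟨ cong +_ (trinomial-! (p ℕ.* N) _ _ _ (trans (rowSum-·ᴿ p r) (cong (p ℕ.*_) h))) ⟩
    + ((p ℕ.* N) !)
      ≡⟨ unitProd-! q N ⟩
    + (p ^ N) * + (N !) * U N
      ≡⟨ cong₂ (λ x y → x * y * U N) powers (trans (cong +_ (sym (trinomial-! N a b c h))) (ℤ.pos-* T _)) ⟩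
    (A * B′ * C′) * (+ T * + (a ! ℕ.* b ! ℕ.* c !)) * U N
      ≡⟨ cong (λ y → (A * B′ * C′) * (+ T * y) * U N) (pos-*³ (a !) (b !) (c !)) ⟩
    (A * B′ * C′) * (+ T * (A! * B! * C!)) * U N
      ≡⟨ lem₂ (A * B′ * C′) (+ T) (A! * B! * C!) (U N) ⟩
    + T * U N * ((A * B′ * C′) * (A! * B! * C!))
      ≡⟨ cong (+ T * U N *_) (sym D-split) ⟩
    + T * U N * + D ∎)
    where
    open ≡-Reasoning
    T = coeff N r
    T′ = coeff (p ℕ.* N) (p ·ᴿ r)
    D = p ^ N ℕ.* (a ! ℕ.* b ! ℕ.* c !)
    D≢0 : ℕ.NonZero D
    D≢0 = ℕ.m*n≢0 (p ^ N) _ {{ℕ.m^n≢0 p N}} {{factorials≢0 a b c}}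
    A = + (p ^ a)
    B′ = + (p ^ b)
    C′ = + (p ^ c)
    A! = + (a !)
    B! = + (b !)
    C! = + (c !)
    powers : + (p ^ N) ≡ A * B′ * C′
    powers = begin
      + (p ^ N)
        ≡⟨ cong (λ n → + (p ^ n)) (sym h) ⟩
      + (p ^ (a ℕ.+ b ℕ.+ c))
        ≡⟨ cong +_ (trans (ℕ.^-distribˡ-+-* p (a ℕ.+ b) c) (cong (ℕ._* p ^ c) (ℕ.^-distribˡ-+-* p a b))) ⟩
      + (p ^ a ℕ.* p ^ b ℕ.* p ^ c)
        ≡⟨ pos-*³ (p ^ a) (p ^ b) (p ^ c) ⟩
      A * B′ * C′ ∎
    D-split : + D ≡ (A * B′ * C′) * (A! * B! * C!)
    D-split = trans (ℤ.pos-* (p ^ N) _) (cong₂ _*_ powers (pos-*³ (a !) (b !) (c !)))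
    fact³ : + ((p ℕ.* a) ! ℕ.* (p ℕ.* b) ! ℕ.* (p ℕ.* c) !) ≡ (A * A! * U a) * (B′ * B! * U b) * (C′ * C! * U c)
    fact³ = trans (pos-*³ ((p ℕ.* a) !) ((p ℕ.* b) !) ((p ℕ.* c) !)) (cong₂ _*_ (cong₂ _*_ (unitProd-! q a) (unitProd-! q b)) (unitProd-! q c))
    lem₁ : ∀ t a b c d e f u v w →
      t * (u * v * w) * ((a * b * c) * (d * e * f)) ≡ t * ((a * d * u) * (b * e * v) * (c * f * w))
    lem₁ = solve-∀
    lem₂ : ∀ x t f u → x * (t * f) * u ≡ t * u * (x * f)
    lem₂ = solve-∀

  -- With u and w the products of unit parts, u T′ = T w, so u (T′ - T) = T (w - u). Here T supplies
  -- p^(2j), w - u supplies p^(2(e+1)), and u is prime to p.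
  weight-step : ∀ {N m} e j → Magic N m → p ^ e ∣ᴹ m → p ^ (j ℕ.+ j) ℕ.∣ weight N m →
    + weight (p ℕ.* N) (p ·ᴹ m) ≡ + weight N m [mod + (p ^ (2 ℕ.* suc (e ℕ.+ j))) ]
  weight-step {N} {r , s , t} e j m (dr , ds , dt) dT =
    mod (prime-power-cancel pp (2 ℕ.* suc (e ℕ.+ j)) u-coprime
      (subst₂ _∣_ power (sym factored) (*-pres-∣ (pos-∣ dT) (diff w≡u))))
    where
    u w T T′ : ℤ
    u = unitRow r * unitRow s * unitRow t
    w = U N * U N * U N
    T = + weight N (r , s , t)
    T′ = + weight (p ℕ.* N) (p ·ᴹ (r , s , t))
    u-coprime : ¬ + p ∣ u
    u-coprime d with euclidℤ pp (unitRow r * unitRow s) (unitRow t) d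
    ... | inj₂ d′ = unitRow-coprime t d′
    ... | inj₁ d′ with euclidℤ pp (unitRow r) (unitRow s) d′
    ...   | inj₁ d″ = unitRow-coprime r d″
    ...   | inj₂ d″ = unitRow-coprime s d″
    w≡u : w ≡ u [mod + (p ^ (suc e ℕ.+ suc e)) ]
    w≡u = mod-* (mod-* (row r (row₁ m) dr) (row s (row₂ m) ds)) (row t (row₃ m) dt)
      where
      row : ∀ r → rowSum r ≡ N → p ^ e ∣ᴿ r → U N ≡ unitRow r [mod + (p ^ (suc e ℕ.+ suc e)) ]
      row r refl d = unitRow-cong e r d
    shuffle : ∀ a b c x y z → (x * y * z) * (a * b * c) ≡ (a * x) * (b * y) * (c * z)
    shuffle = solve-∀
    T′u≡Tw : u * T′ ≡ T * w
    T′u≡Tw = begin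
      u * T′
        ≡⟨ cong (u *_) (pos-*³ (coeff (p ℕ.* N) (p ·ᴿ r)) (coeff (p ℕ.* N) (p ·ᴿ s)) _) ⟩
      u * (+ coeff (p ℕ.* N) (p ·ᴿ r) * + coeff (p ℕ.* N) (p ·ᴿ s) * + coeff (p ℕ.* N) (p ·ᴿ t))
        ≡⟨ shuffle (+ coeff (p ℕ.* N) (p ·ᴿ r)) (+ coeff (p ℕ.* N) (p ·ᴿ s)) (+ coeff (p ℕ.* N) (p ·ᴿ t)) (unitRow r) _ _ ⟩
      (+ coeff (p ℕ.* N) (p ·ᴿ r) * unitRow r) * (+ coeff (p ℕ.* N) (p ·ᴿ s) * unitRow s) *
        (+ coeff (p ℕ.* N) (p ·ᴿ t) * unitRow t)
        ≡⟨ cong₂ _*_ (cong₂ _*_ (coeff-·ᴿ N r) (coeff-·ᴿ N s)) (coeff-·ᴿ N t) ⟩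
      (+ coeff N r * U N) * (+ coeff N s * U N) * (+ coeff N t * U N)
        ≡⟨ sym (shuffle (+ coeff N r) (+ coeff N s) (+ coeff N t) (U N) (U N) (U N)) ⟩
      w * (+ coeff N r * + coeff N s * + coeff N t)
        ≡⟨ cong (w *_) (sym (pos-*³ (coeff N r) (coeff N s) _)) ⟩
      w * T
        ≡⟨ ℤ.*-comm w T ⟩
      T * w ∎
      where open ≡-Reasoning
    factored : u * (T′ - T) ≡ T * (w - u)
    factored = trans (lem₁ u T′ T) (trans (cong (_- u * T) T′u≡Tw) (lem₂ u T w))
      where
      lem₁ : ∀ u t′ t → u * (t′ - t) ≡ u * t′ - u * t
      lem₁ = solve-∀
      lem₂ : ∀ u t w → t * w - u * t ≡ t * (w - u)
      lem₂ = solve-∀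
    power : + (p ^ (j ℕ.+ j)) * + (p ^ (suc e ℕ.+ suc e)) ≡ + (p ^ (2 ℕ.* suc (e ℕ.+ j)))
    power = trans (sym (ℤ.pos-* (p ^ (j ℕ.+ j)) _)) (cong +_
      (trans (sym (ℕ.^-distribˡ-+-* p (j ℕ.+ j) (suc e ℕ.+ suc e))) (cong (p ^_) (lem e j))))
      where
      lem : ∀ e j → j ℕ.+ j ℕ.+ (suc e ℕ.+ suc e) ≡ 2 ℕ.* suc (e ℕ.+ j)
      lem = ℕ.solve-∀

  -- With e + j fixed, `magic-split` either yields the p^(2j) that `weight-step` needs or shows that
  -- p^(e+1) divides the matrix; then e is raised and j lowered. At j = 0 nothing is asked of the
  -- weight.
  weight-cong : ∀ {N m} j e → Magic N m → p ^ e ∣ᴹ m → p ^ (e ℕ.+ j) ℕ.∣ N →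
    + weight (p ℕ.* N) (p ·ᴹ m) ≡ + weight N m [mod + (p ^ (2 ℕ.* suc (e ℕ.+ j))) ]
  weight-cong zero e m d dN = weight-step e 0 m d (ℕ.1∣ _)
  weight-cong {N} {M} (suc j) e m d dN with magic-split pp e j m dN
  ... | inj₂ h = weight-step e (suc j) m d h
  ... | inj₁ h = subst (λ n → + weight (p ℕ.* N) (p ·ᴹ M) ≡ + weight N M [mod + (p ^ (2 ℕ.* suc n)) ])
    (sym (ℕ.+-suc e j)) (weight-cong j (suc e) m h (subst (λ n → p ^ n ℕ.∣ N) (ℕ.+-suc e j) dN))

-- Powers of x³ + y³ + z³ − 3xyz

sumTo-zeros : ∀ m {f} → (∀ i → i ℕ.≤ m → f i ≡ 0ℤ) → sumTo m f ≡ 0ℤ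
sumTo-zeros zero    h = h 0 z≤n
sumTo-zeros (suc m) h = cong₂ _+_ (sumTo-zeros m λ i i≤m → h i (ℕ.m≤n⇒m≤1+n i≤m)) (h (suc m) ℕ.≤-refl)

sumTo-single : ∀ m j {f} → (∀ i → i ≢ j → f i ≡ 0ℤ) → (m ℕ.< j → f j ≡ 0ℤ) → sumTo m f ≡ f j
sumTo-single zero zero    h h′ = refl
sumTo-single zero (suc j) h h′ = trans (h 0 λ ()) (sym (h′ (s≤s z≤n)))
sumTo-single (suc m) j {f} h h′ with suc m ℕ.≟ j
... | yes refl = trans (cong (_+ f j) (sumTo-zeros m λ i i≤m → h i λ { refl → ℕ.1+n≰n i≤m })) (ℤ.+-identityˡ _)
... | no  m≢j  = trans (cong₂ _+_ (sumTo-single m j h λ m<j → h′ (ℕ.≤∧≢⇒< m<j m≢j)) (h _ m≢j)) (ℤ.+-identityʳ _)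

sumTo-extend : ∀ d m {f} → (∀ i → m ℕ.< i → f i ≡ 0ℤ) → sumTo (d ℕ.+ m) f ≡ sumTo m f
sumTo-extend zero    m h = refl
sumTo-extend (suc d) m h =
  trans (cong₂ _+_ (sumTo-extend d m h) (h _ (s≤s (ℕ.m≤n+m m d)))) (ℤ.+-identityʳ _)

sumTo-shift : ∀ m {f g} → f 0 ≡ 0ℤ → (∀ i → f (suc i) ≡ g i) → g m ≡ 0ℤ → sumTo m f ≡ sumTo m g
sumTo-shift m {f} {g} h₀ h h′ = trans (sym (ℤ.+-identityʳ _)) (trans (cong (_+_ (sumTo m f)) (sym h′)) (lem m))
  where
  lem : ∀ m → sumTo m f + g m ≡ sumTo m g
  lem zero    = trans (cong (_+ g 0) h₀) (ℤ.+-identityˡ _)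
  lem (suc m) = cong (_+ g (suc m)) (trans (cong (_+_ (sumTo m f)) (h m)) (lem m))

iterate : ∀ {A : Set} → (A → A) → A → ℕ → A
iterate f x zero    = x
iterate f x (suc n) = iterate f (f x) n

-- A test function assigns a value to the monomial x^a y^b z^c ω^e, and shift d s t is
-- the transpose of the multiplication by x^d + ω^s y^d + ω^t z^d.
Test : Set
Test = ℕ → ℕ → ℕ → ℕ → ℤ

infix 4 _≗₄_
_≗₄_ : Test → Test → Set
F ≗₄ G = ∀ a b c e → F a b c e ≡ G a b c e

≗₄-trans : ∀ {F G H} → F ≗₄ G → G ≗₄ H → F ≗₄ H
≗₄-trans p q a b c e = trans (p a b c e) (q a b c e)

shift : ℕ → ℕ → ℕ → Test → Test
shift d s t F a b c e =
  F (d ℕ.+ a) b c e + F a (d ℕ.+ b) c (s ℕ.+ e) + F a b (d ℕ.+ c) (t ℕ.+ e)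

Extensional : (Test → Test) → Set
Extensional f = ∀ {F G} → F ≗₄ G → f F ≗₄ f G

shift-ext : ∀ d s t → Extensional (shift d s t)
shift-ext d s t h a b c e = cong₂ _+_ (cong₂ _+_ (h _ _ _ _) (h _ _ _ _)) (h _ _ _ _)

iterate-ext : ∀ {f} → Extensional f → ∀ n → Extensional (λ F → iterate f F n)
iterate-ext hf zero    h = h
iterate-ext hf (suc n) h = iterate-ext hf n (hf h)

iterate-comm : ∀ {f g} → Extensional f → Extensional g → (∀ F → f (g F) ≗₄ g (f F)) →
  ∀ n F → f (iterate g F n) ≗₄ iterate g (f F) n
iterate-comm hf hg fg zero    F a b c e = refl
iterate-comm {f} {g} hf hg fg (suc n) F =
  ≗₄-trans (iterate-comm hf hg fg n (g F)) (iterate-ext hg n (fg F))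

-- (f g)^n = f^n g^n for commuting operators. Test functions are compared pointwise, so the
-- operators must respect pointwise equality.
iterate-∘ : ∀ {f g} → Extensional f → Extensional g → (∀ F → f (g F) ≗₄ g (f F)) →
  ∀ n F → iterate (f ∘ g) F n ≗₄ iterate f (iterate g F n) n
iterate-∘ hf hg fg zero    F a b c e = refl
iterate-∘ {f} {g} hf hg fg (suc n) F =
  ≗₄-trans (iterate-∘ hf hg fg n (f (g F)))
    (iterate-ext hf n λ a b c e → sym (iterate-comm hf hg fg n (g F) a b c e))

-- The multinomial theorem, transposed. The box size `m` stays fixed while `n` grows, so that the
-- index shifts in Pascal's rule lose nothing: at the edge of the box the coefficients of degree n <
-- m are 0.
shift-expand : ∀ {d s t m} n → n ℕ.≤ m → ∀ F a b c e →
  iterate (shift d s t) F n a b c e ≡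
  box m λ (x , y , z) → + trinomial n x y z *
    F (x ℕ.* d ℕ.+ a) (y ℕ.* d ℕ.+ b) (z ℕ.* d ℕ.+ c) (y ℕ.* s ℕ.+ (z ℕ.* t ℕ.+ e))
shift-expand {d} {s} {t} {m} zero _ F a b c e = sym (begin
  box m (λ (x , y , z) → term x y z)
    ≡⟨ sumTo-single m 0 (λ { zero h → ⊥-elim (h refl)
         ; (suc x) _ → sumTo-zeros m λ y _ → sumTo-zeros m λ z _ → refl }) (λ ()) ⟩
  (sumTo m λ y → sumTo m λ z → term 0 y z)
    ≡⟨ sumTo-single m 0 (λ { zero h → ⊥-elim (h refl) ; (suc y) _ → sumTo-zeros m λ z _ → refl }) (λ ()) ⟩
  (sumTo m λ z → term 0 0 z)
    ≡⟨ sumTo-single m 0 (λ { zero h → ⊥-elim (h refl) ; (suc z) _ → refl }) (λ ()) ⟩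
  1ℤ * F a b c e
    ≡⟨ ℤ.*-identityˡ _ ⟩
  F a b c e ∎)
  where
  open ≡-Reasoning
  term : ℕ → ℕ → ℕ → ℤ
  term x y z = + trinomial 0 x y z *
    F (x ℕ.* d ℕ.+ a) (y ℕ.* d ℕ.+ b) (z ℕ.* d ℕ.+ c) (y ℕ.* s ℕ.+ (z ℕ.* t ℕ.+ e))
shift-expand {d} {s} {t} {m} (suc n) n<m F a b c e = begin
  iterate (shift d s t) (shift d s t F) n a b c e
    ≡⟨ shift-expand n (ℕ.<⇒≤ n<m) (shift d s t F) a b c e ⟩
  box m (λ (x , y , z) → + trinomial n x y z * shift d s t F (X x) (Y y) (Z z) (E y z))
    ≡⟨ ext (box-linear m) (λ (x , y , z) → split x y z) ⟩
  box m (λ (x , y , z) → x-term x y z + y-term x y z + z-term x y z)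
    ≡⟨ add₃ _ _ _ ⟩
  box m (λ (x , y , z) → x-term x y z) + box m (λ (x , y , z) → y-term x y z) + box m (λ (x , y , z) → z-term x y z)
    ≡⟨ sym (cong₂ _+_ (cong₂ _+_ x-shift y-shift) z-shift) ⟩
  box m (λ (x , y , z) → + afterPred (λ x → trinomial n x y z) x * V x y z) +
    box m (λ (x , y , z) → + afterPred (λ y → trinomial n x y z) y * V x y z) +
    box m (λ (x , y , z) → + afterPred (λ z → trinomial n x y z) z * V x y z)
    ≡⟨ sym (add₃ _ _ _) ⟩
  box m (λ (x , y , z) → + afterPred (λ x → trinomial n x y z) x * V x y z +
    + afterPred (λ y → trinomial n x y z) y * V x y z + + afterPred (λ z → trinomial n x y z) z * V x y z)
    ≡⟨ ext (box-linear m) (λ (x , y , z) → sym (distrib (+ afterPred (λ x → trinomial n x y z) x)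
         (+ afterPred (λ y → trinomial n x y z) y) (+ afterPred (λ z → trinomial n x y z) z) (V x y z))) ⟩
  box m (λ (x , y , z) → + trinomial (suc n) x y z * V x y z) ∎
  where
  open ≡-Reasoning
  X Y Z : ℕ → ℕ
  X x = x ℕ.* d ℕ.+ a
  Y y = y ℕ.* d ℕ.+ b
  Z z = z ℕ.* d ℕ.+ c
  E : ℕ → ℕ → ℕ
  E y z = y ℕ.* s ℕ.+ (z ℕ.* t ℕ.+ e)
  V x-term y-term z-term : ℕ → ℕ → ℕ → ℤ
  V x y z = F (X x) (Y y) (Z z) (E y z)
  x-term x y z = + trinomial n x y z * V (suc x) y z
  y-term x y z = + trinomial n x y z * V x (suc y) z
  z-term x y z = + trinomial n x y z * V x y (suc z)
  distrib : ∀ p q r v → (p + q + r) * v ≡ p * v + q * v + r * v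
  distrib = solve-∀
  distribˡ : ∀ v p q r → v * (p + q + r) ≡ v * p + v * q + v * r
  distribˡ = solve-∀
  split : ∀ x y z → + trinomial n x y z * shift d s t F (X x) (Y y) (Z z) (E y z) ≡
                    x-term x y z + y-term x y z + z-term x y z
  split x y z = trans
    (cong (+ trinomial n x y z *_) (cong₂ _+_ (cong₂ _+_
      (cong (λ k → F k (Y y) (Z z) (E y z)) (sym (ℕ.+-assoc d (x ℕ.* d) a)))
      (cong₂ (λ k l → F (X x) k (Z z) l) (sym (ℕ.+-assoc d (y ℕ.* d) b)) (sym (ℕ.+-assoc s (y ℕ.* s) _))))
      (cong₂ (λ k l → F (X x) (Y y) k l) (sym (ℕ.+-assoc d (z ℕ.* d) c)) (lem t (y ℕ.* s) (z ℕ.* t) e))))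
    (distribˡ (+ trinomial n x y z) (V (suc x) y z) (V x (suc y) z) (V x y (suc z)))
    where
    lem : ∀ t y z e → t ℕ.+ (y ℕ.+ (z ℕ.+ e)) ≡ y ℕ.+ (t ℕ.+ z ℕ.+ e)
    lem = ℕ.solve-∀
  add₃ : ∀ (f g h : Row → ℤ) → box m (λ r → f r + g r + h r) ≡ box m f + box m g + box m h
  add₃ f g h = trans (add (box-linear m) (λ r → f r + g r) h) (cong (_+ box m h) (add (box-linear m) f g))
  vanish : ∀ x y z → n ℕ.< x ℕ.+ y ℕ.+ z → ∀ v → + trinomial n x y z * v ≡ 0ℤ
  vanish x y z h v = trans (cong (λ k → + k * v) (trinomial≡0 n x y z λ eq → ℕ.<⇒≢ h (sym eq))) (ℤ.*-zeroˡ v)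
  x-shift : box m (λ (x , y , z) → + afterPred (λ x → trinomial n x y z) x * V x y z) ≡ box m (λ (x , y , z) → x-term x y z)
  x-shift = sumTo-shift m (sumTo-zeros m λ y _ → sumTo-zeros m λ z _ → refl) (λ x → refl)
    (sumTo-zeros m λ y _ → sumTo-zeros m λ z _ →
      vanish m y z (ℕ.<-≤-trans n<m (ℕ.≤-trans (ℕ.m≤m+n m y) (ℕ.m≤m+n (m ℕ.+ y) z))) (V (suc m) y z))
  y-shift : box m (λ (x , y , z) → + afterPred (λ y → trinomial n x y z) y * V x y z) ≡ box m (λ (x , y , z) → y-term x y z)
  y-shift = ext (sumTo-linear m) λ x → sumTo-shift m (sumTo-zeros m λ z _ → refl) (λ y → refl)
    (sumTo-zeros m λ z _ →
      vanish x m z (ℕ.<-≤-trans n<m (ℕ.≤-trans (ℕ.m≤n+m m x) (ℕ.m≤m+n (x ℕ.+ m) z))) (V x (suc m) z))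
  z-shift : box m (λ (x , y , z) → + afterPred (λ z → trinomial n x y z) z * V x y z) ≡ box m (λ (x , y , z) → z-term x y z)
  z-shift = ext (sumTo-linear m) λ x → ext (sumTo-linear m) λ y → sumTo-shift m refl (λ z → refl)
    (vanish x y m (ℕ.<-≤-trans n<m (ℕ.m≤n+m m (x ℕ.+ y))) (V x y (suc m)))

-- Factor i carries ω^(i j) at variable j, for i, j in 0, 1, 2. The exponents are not reduced modulo
-- 3, whence the 4.
L₀ L₁ L₂ : Test → Test
L₀ = shift 1 0 0
L₁ = shift 1 1 2
L₂ = shift 1 2 4

transpose₉ : ∀ a b c d e f g h i → (a + b + c) + (d + e + f) + (g + h + i) ≡ (a + d + g) + (b + e + h) + (c + f + i)
transpose₉ = solve-∀

shift-comm : ∀ s t s′ t′ F → shift 1 s t (shift 1 s′ t′ F) ≗₄ shift 1 s′ t′ (shift 1 s t F)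
shift-comm s t s′ t′ F a b c e = trans
  (transpose₉ (F (2 ℕ.+ a) b c e) (F (1 ℕ.+ a) (1 ℕ.+ b) c (s′ ℕ.+ e)) (F (1 ℕ.+ a) b (1 ℕ.+ c) (t′ ℕ.+ e))
    (F (1 ℕ.+ a) (1 ℕ.+ b) c (s ℕ.+ e)) (F a (2 ℕ.+ b) c (s′ ℕ.+ (s ℕ.+ e))) (F a (1 ℕ.+ b) (1 ℕ.+ c) (t′ ℕ.+ (s ℕ.+ e)))
    (F (1 ℕ.+ a) b (1 ℕ.+ c) (t ℕ.+ e)) (F a (1 ℕ.+ b) (1 ℕ.+ c) (s′ ℕ.+ (t ℕ.+ e))) (F a b (2 ℕ.+ c) (t′ ℕ.+ (t ℕ.+ e))))
  (trans (cong₂ (λ i j → transposed i j (t′ ℕ.+ (s ℕ.+ e)) (t′ ℕ.+ (t ℕ.+ e))) (lem s′ s e) (lem s′ t e))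
         (cong₂ (transposed (s ℕ.+ (s′ ℕ.+ e)) (t ℕ.+ (s′ ℕ.+ e))) (lem t′ s e) (lem t′ t e)))
  where
  transposed : ℕ → ℕ → ℕ → ℕ → ℤ
  transposed i j k l =
    (F (2 ℕ.+ a) b c e + F (1 ℕ.+ a) (1 ℕ.+ b) c (s ℕ.+ e) + F (1 ℕ.+ a) b (1 ℕ.+ c) (t ℕ.+ e)) +
    (F (1 ℕ.+ a) (1 ℕ.+ b) c (s′ ℕ.+ e) + F a (2 ℕ.+ b) c i + F a (1 ℕ.+ b) (1 ℕ.+ c) j) +
    (F (1 ℕ.+ a) b (1 ℕ.+ c) (t′ ℕ.+ e) + F a (1 ℕ.+ b) (1 ℕ.+ c) k + F a b (2 ℕ.+ c) l)
  lem : ∀ u v e → u ℕ.+ (v ℕ.+ e) ≡ v ℕ.+ (u ℕ.+ e)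
  lem = ℕ.solve-∀

norm : Test → Test
norm = L₀ ∘ L₁ ∘ L₂

norm-ext : Extensional norm
norm-ext = shift-ext 1 0 0 ∘ shift-ext 1 1 2 ∘ shift-ext 1 2 4

iterate-norm : ∀ n F → iterate norm F n ≗₄ iterate L₀ (iterate L₁ (iterate L₂ F n) n) n
iterate-norm n F = ≗₄-trans
  (iterate-∘ (shift-ext 1 0 0) (shift-ext 1 1 2 ∘ shift-ext 1 2 4)
    (λ F → ≗₄-trans (shift-comm 0 0 1 2 (L₂ F)) (shift-ext 1 1 2 (shift-comm 0 0 2 4 F))) n F)
  (iterate-ext (shift-ext 1 0 0) n (iterate-∘ (shift-ext 1 1 2) (shift-ext 1 2 4) (shift-comm 1 2 2 4) n F))

-- ψ e is the trace of ω^e, for ω a primitive cube root of unity.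
ψ : ℕ → ℤ
ψ 0 = + 2
ψ 1 = - 1ℤ
ψ 2 = - 1ℤ
ψ (suc (suc (suc e))) = ψ e

-- This is 1 + ω + ω² = 0. Together with ω³ = 1, which holds by computation, it replaces arithmetic
-- in ℤ[ω].
ψ-sum : ∀ e → ψ e + ψ (1 ℕ.+ e) + ψ (2 ℕ.+ e) ≡ 0ℤ
ψ-sum 0 = refl
ψ-sum 1 = refl
ψ-sum 2 = refl
ψ-sum (suc (suc (suc e))) = ψ-sum e

Test₃ : Set
Test₃ = ℕ → ℕ → ℕ → ℤ

twist : Test₃ → Test
twist g a b c e = g a b c * ψ e

cubes cubic : Test₃ → Test₃
cubes g a b c = g (3 ℕ.+ a) b c + g a (3 ℕ.+ b) c + g a b (3 ℕ.+ c)
cubic g a b c = cubes g a b c + - + 3 * g a b c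

-- Such a functional does not see a factor xyz; this is why -3xyz appears in `cubic` as the constant
-- -3.
Invariant : Test₃ → Set
Invariant g = ∀ a b c → g (suc a) (suc b) (suc c) ≡ g a b c

cubic-invariant : ∀ {g} → Invariant g → Invariant (cubic g)
cubic-invariant h a b c =
  cong₂ (λ u v → u + - + 3 * v) (cong₂ _+_ (cong₂ _+_ (h _ _ _) (h _ _ _)) (h _ _ _)) (h _ _ _)

-- (x + y + z)(x + ωy + ω²z)(x + ω²y + ωz) = x³ + y³ + z³ − 3xyz
norm-twist : ∀ {g} → Invariant g → norm (twist g) ≗₄ twist (cubic g)
norm-twist {g} h a b c e = trans
  (collect (g (3 ℕ.+ a) b c) (g a (3 ℕ.+ b) c) (g a b (3 ℕ.+ c))
    (g (2 ℕ.+ a) (1 ℕ.+ b) c) (g (2 ℕ.+ a) b (1 ℕ.+ c)) (g (1 ℕ.+ a) (2 ℕ.+ b) c)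
    (g a (2 ℕ.+ b) (1 ℕ.+ c)) (g (1 ℕ.+ a) b (2 ℕ.+ c)) (g a (1 ℕ.+ b) (2 ℕ.+ c))
    (g (1 ℕ.+ a) (1 ℕ.+ b) (1 ℕ.+ c)) (ψ e) (ψ (1 ℕ.+ e)) (ψ (2 ℕ.+ e)))
  (trans (cong₂ (λ u v → (cubes g a b c + - + 3 * u) * ψ e + v * mixed) (h a b c) (ψ-sum e))
    (trans (cong (_+_ (cubic g a b c * ψ e)) (ℤ.*-zeroˡ mixed)) (ℤ.+-identityʳ _)))
  where
  -- A monomial such as x²y receives 1 + ω + ω², and xyz receives 3ω + 3ω² = -3 + 3(1 + ω + ω²). The
  -- cofactors of 1 + ω + ω² are collected here.
  mixed : ℤ
  mixed = g (2 ℕ.+ a) (1 ℕ.+ b) c + g (2 ℕ.+ a) b (1 ℕ.+ c) + g (1 ℕ.+ a) (2 ℕ.+ b) c +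
    g a (2 ℕ.+ b) (1 ℕ.+ c) + g (1 ℕ.+ a) b (2 ℕ.+ c) + g a (1 ℕ.+ b) (2 ℕ.+ c) +
    + 3 * g (1 ℕ.+ a) (1 ℕ.+ b) (1 ℕ.+ c)
  collect : ∀ g300 g030 g003 g210 g201 g120 g021 g102 g012 g111 x0 x1 x2 →
     ((g300 * x0 + g210 * x2 + g201 * x1) + (g210 * x1 + g120 * x0 + g111 * x2) + (g201 * x2 + g111 * x1 + g102 * x0)) +
     ((g210 * x0 + g120 * x2 + g111 * x1) + (g120 * x1 + g030 * x0 + g021 * x2) + (g111 * x2 + g021 * x1 + g012 * x0)) +
     ((g201 * x0 + g111 * x2 + g102 * x1) + (g111 * x1 + g021 * x0 + g012 * x2) + (g102 * x2 + g012 * x1 + g003 * x0))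
     ≡ ((g300 + g030 + g003) + - + 3 * g111) * x0 +
       (x0 + x1 + x2) * (g210 + g201 + g120 + g021 + g102 + g012 + + 3 * g111)
  collect = solve-∀

iterate-norm-twist : ∀ {g} → Invariant g → ∀ n → iterate norm (twist g) n ≗₄ twist (iterate cubic g n)
iterate-norm-twist h zero a b c e = refl
iterate-norm-twist h (suc n) = ≗₄-trans (iterate-ext norm-ext n (norm-twist h))
  (iterate-norm-twist (cubic-invariant h) n)

iterate-cubes-linear : ∀ {h f g : Test₃} k → (∀ a b c → h a b c ≡ f a b c + k * g a b c) →
  ∀ i a b c → iterate cubes h i a b c ≡ iterate cubes f i a b c + k * iterate cubes g i a b c
iterate-cubes-linear k eq zero = eq
iterate-cubes-linear {h} {f} {g} k eq (suc i) = iterate-cubes-linear k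
  (λ a b c → trans (cong₂ _+_ (cong₂ _+_ (eq _ _ _) (eq _ _ _)) (eq _ _ _))
     (lem k (f (3 ℕ.+ a) b c) (f a (3 ℕ.+ b) c) (f a b (3 ℕ.+ c)) (g (3 ℕ.+ a) b c) (g a (3 ℕ.+ b) c) (g a b (3 ℕ.+ c)))) i
  where
  lem : ∀ k x y z u v w → (x + k * u) + (y + k * v) + (z + k * w) ≡ (x + y + z) + k * (u + v + w)
  lem = solve-∀

-- The coefficient of X^i in (X − 3)^n.
binom₋₃ : ℕ → ℕ → ℤ
binom₋₃ zero    zero    = 1ℤ
binom₋₃ zero    (suc i) = 0ℤ
binom₋₃ (suc n) zero    = - + 3 * binom₋₃ n zero
binom₋₃ (suc n) (suc i) = binom₋₃ n i + - + 3 * binom₋₃ n (suc i)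

binom₋₃≡0 : ∀ {n i} → n ℕ.< i → binom₋₃ n i ≡ 0ℤ
binom₋₃≡0 {zero}  {suc i} _ = refl
binom₋₃≡0 {suc n} {suc i} (s≤s n<i) = cong₂ (λ x y → x + - + 3 * y) (binom₋₃≡0 n<i) (binom₋₃≡0 (ℕ.m<n⇒m<1+n n<i))

-- The binomial theorem for the operator `cubes` - 3.
cubic-expand : ∀ {m} n → n ℕ.≤ m → ∀ g a b c →
  iterate cubic g n a b c ≡ sumTo m λ i → binom₋₃ n i * iterate cubes g i a b c
cubic-expand {m} zero _ g a b c = sym (trans
  (sumTo-single m 0 (λ { zero h → ⊥-elim (h refl) ; (suc i) _ → refl }) (λ ())) (ℤ.*-identityˡ _))
cubic-expand {m} (suc n) n<m g a b c = begin
  iterate cubic (cubic g) n a b c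
    ≡⟨ cubic-expand n (ℕ.<⇒≤ n<m) (cubic g) a b c ⟩
  (sumTo m λ i → β i * iterate cubes (cubic g) i a b c)
    ≡⟨ ext (sumTo-linear m) (λ i → trans
         (cong (β i *_) (iterate-cubes-linear {cubic g} {cubes g} {g} (- + 3) (λ _ _ _ → refl) i a b c))
         (lem₁ (β i) (G (suc i)) (G i))) ⟩
  (sumTo m λ i → β i * G (suc i) + - + 3 * β i * G i)
    ≡⟨ add (sumTo-linear m) _ _ ⟩
  sumTo m (λ i → β i * G (suc i)) + sumTo m (λ i → - + 3 * β i * G i)
    ≡⟨ cong (_+ sumTo m (λ i → - + 3 * β i * G i)) (sym (sumTo-shift m {λ i → pred-β i * G i} refl (λ i → refl)
         (trans (cong (_* G (suc m)) (binom₋₃≡0 n<m)) refl))) ⟩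
  sumTo m (λ i → pred-β i * G i) + sumTo m (λ i → - + 3 * β i * G i)
    ≡⟨ sym (add (sumTo-linear m) _ _) ⟩
  (sumTo m λ i → pred-β i * G i + - + 3 * β i * G i)
    ≡⟨ ext (sumTo-linear m) (λ i → trans (sym (ℤ.*-distribʳ-+ (G i) (pred-β i) (- + 3 * β i)))
         (cong (_* G i) (step i))) ⟩
  (sumTo m λ i → binom₋₃ (suc n) i * G i) ∎
  where
  open ≡-Reasoning
  β G pred-β : ℕ → ℤ
  β = binom₋₃ n
  G i = iterate cubes g i a b c
  pred-β zero    = 0ℤ
  pred-β (suc i) = β i
  lem₁ : ∀ x y z → x * (y + - + 3 * z) ≡ x * y + - + 3 * x * z
  lem₁ = solve-∀
  step : ∀ i → pred-β i + - + 3 * β i ≡ binom₋₃ (suc n) i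
  step zero    = ℤ.+-identityˡ _
  step (suc i) = refl

binom₋₃-closed : ∀ n i → binom₋₃ n i ≡ + (n C i) * (sign (n ∸ i) * + (3 ^ (n ∸ i)))
binom₋₃-closed zero zero = refl
binom₋₃-closed zero (suc i) = refl
binom₋₃-closed (suc n) zero = trans (cong (- + 3 *_) (binom₋₃-closed n zero))
  (trans (lem (sign n) (+ (3 ^ n))) (cong (λ x → 1ℤ * (- sign n * x)) (sym (ℤ.pos-* 3 (3 ^ n)))))
  where
  lem : ∀ s t → - + 3 * (1ℤ * (s * t)) ≡ 1ℤ * (- s * (+ 3 * t))
  lem = solve-∀
binom₋₃-closed (suc n) (suc i) = begin
  binom₋₃ n i + - + 3 * binom₋₃ n (suc i)
    ≡⟨ cong₂ (λ x y → x + - + 3 * y) (binom₋₃-closed n i) (binom₋₃-closed n (suc i)) ⟩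
  + (n C i) * w + - + 3 * (+ (n C suc i) * (sign (n ∸ suc i) * + (3 ^ (n ∸ suc i))))
    ≡⟨ cong (_+_ (+ (n C i) * w)) second ⟩
  + (n C i) * w + + (n C suc i) * w
    ≡⟨ sym (ℤ.*-distribʳ-+ w (+ (n C i)) (+ (n C suc i))) ⟩
  + (n C i ℕ.+ n C suc i) * w
    ≡⟨ cong (λ x → + x * w) (nCk+nC[k+1]≡[n+1]C[k+1] n i) ⟩
  + (suc n C suc i) * w ∎
  where
  open ≡-Reasoning
  w = sign (n ∸ i) * + (3 ^ (n ∸ i))
  second : - + 3 * (+ (n C suc i) * (sign (n ∸ suc i) * + (3 ^ (n ∸ suc i)))) ≡ + (n C suc i) * w
  second with suc i ℕ.≤? n
  -- For i ≥ n the truncated subtractions no longer differ by 1, but the binomial coefficient is 0.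
  ... | no h rewrite k>n⇒nCk≡0 (ℕ.≰⇒> h) = refl
  ... | yes h = trans (lem (+ (n C suc i)) (sign (n ∸ suc i)) (+ (3 ^ (n ∸ suc i))))
    (trans (cong (λ x → + (n C suc i) * (- sign (n ∸ suc i) * x)) (sym (ℤ.pos-* 3 (3 ^ (n ∸ suc i)))))
      (cong (λ k → + (n C suc i) * (sign k * + (3 ^ k))) (sym (ℕ.+-∸-assoc 1 h))))
    where
    lem : ∀ c s t → - + 3 * (c * (s * t)) ≡ c * (- s * (+ 3 * t))
    lem = solve-∀

-- The diagonal coefficient and Zagier's sequence

δ : ℕ → ℕ → ℤ
δ zero    zero    = 1ℤ
δ zero    (suc b) = 0ℤ
δ (suc a) zero    = 0ℤ
δ (suc a) (suc b) = δ a b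

δ-refl : ∀ a → δ a a ≡ 1ℤ
δ-refl zero    = refl
δ-refl (suc a) = δ-refl a

δ≡0 : ∀ {a b} → a ≢ b → δ a b ≡ 0ℤ
δ≡0 {zero}  {zero}  h = ⊥-elim (h refl)
δ≡0 {zero}  {suc b} h = refl
δ≡0 {suc a} {zero}  h = refl
δ≡0 {suc a} {suc b} h = δ≡0 (h ∘ cong suc)

diagonal : Test₃
diagonal a b c = δ a b * δ b c

-- `cubes` is the case d = 3 with no powers of ω, so that `shift-expand` covers (x³ + y³ + z³)^i as
-- well.
cubes-shift : ∀ g i a b c → iterate cubes g i a b c ≡ iterate (shift 3 0 0) (λ a b c _ → g a b c) i a b c 0
cubes-shift g zero    a b c = refl
cubes-shift g (suc i) a b c = cubes-shift (cubes g) i a b c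

cubes-diagonal : ∀ {i m} → i ℕ.≤ m → iterate cubes diagonal i 0 0 0 ≡ sumTo m λ x → + trinomial i x x x
cubes-diagonal {i} {m} i≤m = begin
  iterate cubes diagonal i 0 0 0
    ≡⟨ cubes-shift diagonal i 0 0 0 ⟩
  iterate (shift 3 0 0) (λ a b c _ → diagonal a b c) i 0 0 0 0
    ≡⟨ shift-expand i i≤m _ 0 0 0 0 ⟩
  (sumTo m λ x → sumTo m λ y → sumTo m λ z → term x y z)
    ≡⟨ ext (sumTo-linear m) (λ x → ext (sumTo-linear m) λ y → sumTo-single m y (offz x y) (outz x y)) ⟩
  (sumTo m λ x → sumTo m λ y → term x y y)
    ≡⟨ ext (sumTo-linear m) (λ x → sumTo-single m x (offy x) (outy x)) ⟩
  (sumTo m λ x → term x x x)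
    ≡⟨ ext (sumTo-linear m) (λ x → trans
         (cong (λ d → + trinomial i x x x * (d * d)) (δ-refl (x ℕ.* 3 ℕ.+ 0))) (ℤ.*-identityʳ _)) ⟩
  (sumTo m λ x → + trinomial i x x x) ∎
  where
  open ≡-Reasoning
  term : ℕ → ℕ → ℕ → ℤ
  term x y z = + trinomial i x y z * diagonal (x ℕ.* 3 ℕ.+ 0) (y ℕ.* 3 ℕ.+ 0) (z ℕ.* 3 ℕ.+ 0)
  δ3≡0 : ∀ {x y} → x ≢ y → δ (x ℕ.* 3 ℕ.+ 0) (y ℕ.* 3 ℕ.+ 0) ≡ 0ℤ
  δ3≡0 {x} {y} h = δ≡0 λ eq → h (ℕ.*-cancelʳ-≡ x y 3 (ℕ.+-cancelʳ-≡ 0 _ _ eq))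
  vanish : ∀ {x y z} → i ℕ.< x ℕ.+ y ℕ.+ z → ∀ v → + trinomial i x y z * v ≡ 0ℤ
  vanish {x} {y} {z} h v = trans (cong (λ k → + k * v) (trinomial≡0 i x y z λ eq → ℕ.<⇒≢ h (sym eq))) (ℤ.*-zeroˡ v)
  offz : ∀ x y z → z ≢ y → term x y z ≡ 0ℤ
  offz x y z h = trans (cong (λ d → + trinomial i x y z * (δ (x ℕ.* 3 ℕ.+ 0) (y ℕ.* 3 ℕ.+ 0) * d)) (δ3≡0 {y} {z} (h ∘ sym)))
    (trans (cong (+ trinomial i x y z *_) (ℤ.*-zeroʳ (δ (x ℕ.* 3 ℕ.+ 0) _))) (ℤ.*-zeroʳ (+ trinomial i x y z)))
  offy : ∀ x y → y ≢ x → term x y y ≡ 0ℤ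
  offy x y h = trans (cong (λ d → + trinomial i x y y * (d * δ (y ℕ.* 3 ℕ.+ 0) (y ℕ.* 3 ℕ.+ 0))) (δ3≡0 {x} {y} (h ∘ sym)))
    (ℤ.*-zeroʳ (+ trinomial i x y y))
  outz : ∀ x y → m ℕ.< y → term x y y ≡ 0ℤ
  outz x y h = vanish (ℕ.≤-<-trans i≤m (ℕ.<-≤-trans h (ℕ.m≤n+m y (x ℕ.+ y)))) _
  outy : ∀ x → m ℕ.< x → term x x x ≡ 0ℤ
  outy x = outz x x

sign-+ : ∀ a b → sign (a ℕ.+ b) ≡ sign a * sign b
sign-+ zero    b = sym (ℤ.*-identityˡ _)
sign-+ (suc a) b = trans (cong -_ (sign-+ a b)) (ℤ.neg-distribˡ-* (sign a) (sign b))

sign² : ∀ a → sign a * sign a ≡ 1ℤ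
sign² zero    = refl
sign² (suc a) = trans (lem (sign a)) (sign² a)
  where
  lem : ∀ s → - s * - s ≡ s * s
  lem = solve-∀

C-! : ∀ {n k} → k ℕ.≤ n → (n C k) ℕ.* (k ! ℕ.* (n ∸ k) !) ≡ n !
C-! {n} {k} k≤n = trans (cong (ℕ._* (k ! ℕ.* (n ∸ k) !)) (nCk≡n!/k![n-k]! k≤n))
  (ℕ.m/n*n≡m {{k ℕ.!* (n ∸ k) !≢0}} (k![n∸k]!∣n! k≤n))

trinomial-central : ∀ k → trinomial (3 ℕ.* k) k k k ≡ ((3 ℕ.* k) C (2 ℕ.* k)) ℕ.* ((2 ℕ.* k) C k)
trinomial-central k = ℕ.*-cancelʳ-≡ _ _ (k ! ℕ.* k ! ℕ.* k !) {{factorials≢0 k k k}} (begin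
  trinomial (3 ℕ.* k) k k k ℕ.* (k ! ℕ.* k ! ℕ.* k !)
    ≡⟨ trinomial-! (3 ℕ.* k) k k k (lem₁ k) ⟩
  (3 ℕ.* k) !
    ≡⟨ sym (C-! {3 ℕ.* k} {2 ℕ.* k} (ℕ.*-monoˡ-≤ k (ℕ.n≤1+n 2))) ⟩
  X ℕ.* ((2 ℕ.* k) ! ℕ.* (3 ℕ.* k ∸ 2 ℕ.* k) !)
    ≡⟨ cong₂ (λ u v → X ℕ.* (u ℕ.* v !)) (sym (C-! {2 ℕ.* k} {k} (ℕ.m≤m+n k _))) (ℕ.m+n∸n≡m k (2 ℕ.* k)) ⟩
  X ℕ.* (Y ℕ.* (k ! ℕ.* (2 ℕ.* k ∸ k) !) ℕ.* k !)
    ≡⟨ cong (λ v → X ℕ.* (Y ℕ.* (k ! ℕ.* v !) ℕ.* k !)) (trans (ℕ.m+n∸m≡n k (k ℕ.+ 0)) (ℕ.+-identityʳ k)) ⟩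
  X ℕ.* (Y ℕ.* (k ! ℕ.* k !) ℕ.* k !)
    ≡⟨ lem₂ X Y (k !) ⟩
  X ℕ.* Y ℕ.* (k ! ℕ.* k ! ℕ.* k !) ∎)
  where
  open ≡-Reasoning
  X = (3 ℕ.* k) C (2 ℕ.* k)
  Y = (2 ℕ.* k) C k
  lem₁ : ∀ k → k ℕ.+ k ℕ.+ k ≡ 3 ℕ.* k
  lem₁ = ℕ.solve-∀
  lem₂ : ∀ x y f → x ℕ.* (y ℕ.* (f ℕ.* f) ℕ.* f) ≡ x ℕ.* y ℕ.* (f ℕ.* f ℕ.* f)
  lem₂ = ℕ.solve-∀

B-term : ℕ → ℕ → ℤ
B-term n k = sign k * + (3 ^ (n ∸ 3 ℕ.* k) ℕ.* (n C (3 ℕ.* k)) ℕ.* ((3 ℕ.* k) C (2 ℕ.* k)) ℕ.* ((2 ℕ.* k) C k))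

B-term≡0 : ∀ {n k} → n ℕ.< 3 ℕ.* k → B-term n k ≡ 0ℤ
B-term≡0 {n} {k} h rewrite k>n⇒nCk≡0 h | ℕ.*-zeroʳ (3 ^ (n ∸ 3 ℕ.* k)) = ℤ.*-zeroʳ (sign k)

B-extended : ∀ n → B n ≡ sumTo n (B-term n)
B-extended n = sym (trans (cong (λ m → sumTo m (B-term n)) (sym (ℕ.m∸n+n≡m (ℕ.m/n≤m n 3))))
  (sumTo-extend (n ∸ n ℕ./ 3) (n ℕ./ 3) λ i h → B-term≡0 {n} {i} (ℕ.≰⇒> λ 3i≤n → ℕ.<⇒≱ h
    (subst (ℕ._≤ n ℕ./ 3) (trans (ℕ./-congˡ (ℕ.*-comm 3 i)) (ℕ.m*n/n≡m i 3)) (ℕ./-monoˡ-≤ 3 3i≤n)))))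

-- The global sign arises from (-1)^(n - 3k) = (-1)^n (-1)^k; the trinomial coefficient is
-- (3k)!/k!³.
signed-B-term : ∀ n k → binom₋₃ n (3 ℕ.* k) * + trinomial (3 ℕ.* k) k k k ≡ sign n * B-term n k
signed-B-term n k with 3 ℕ.* k ℕ.≤? n
... | no h = trans (cong (_* + trinomial (3 ℕ.* k) k k k) (binom₋₃≡0 (ℕ.≰⇒> h)))
  (sym (trans (cong (sign n *_) (B-term≡0 {n} {k} (ℕ.≰⇒> h))) (ℤ.*-zeroʳ (sign n))))
... | yes h = begin
  binom₋₃ n (3 ℕ.* k) * + trinomial (3 ℕ.* k) k k k
    ≡⟨ cong₂ _*_ (binom₋₃-closed n (3 ℕ.* k)) (trans (cong +_ (trinomial-central k)) (ℤ.pos-* Y Z)) ⟩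
  + X * (sign d * + (3 ^ d)) * (+ Y * + Z)
    ≡⟨ cong (λ s → + X * (s * + (3 ^ d)) * (+ Y * + Z)) sign-d ⟩
  + X * (sign n * sign k * + (3 ^ d)) * (+ Y * + Z)
    ≡⟨ lem (+ X) (sign n) (sign k) (+ (3 ^ d)) (+ Y) (+ Z) ⟩
  sign n * (sign k * (+ (3 ^ d) * + X * + Y * + Z))
    ≡⟨ cong (λ x → sign n * (sign k * x)) (sym (trans (ℤ.pos-* (3 ^ d ℕ.* X ℕ.* Y) Z) (cong (_* + Z) (pos-*³ (3 ^ d) X Y)))) ⟩
  sign n * B-term n k ∎
  where
  open ≡-Reasoning
  d = n ∸ 3 ℕ.* k
  X = n C (3 ℕ.* k)
  Y = (3 ℕ.* k) C (2 ℕ.* k)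
  Z = (2 ℕ.* k) C k
  lem : ∀ x s t u y z → x * (s * t * u) * (y * z) ≡ s * (t * (u * x * y * z))
  lem = solve-∀
  sign-3k : sign (3 ℕ.* k) ≡ sign k
  sign-3k = trans (sign-+ k (k ℕ.+ (k ℕ.+ 0))) (trans (cong (sign k *_) (trans (sign-+ k (k ℕ.+ 0))
    (trans (cong (λ j → sign k * sign j) (ℕ.+-identityʳ k)) (sign² k)))) (ℤ.*-identityʳ _))
  sign-d : sign d ≡ sign n * sign k
  sign-d = begin
    sign d
      ≡⟨ sym (ℤ.*-identityʳ _) ⟩
    sign d * 1ℤ
      ≡⟨ cong (sign d *_) (sym (sign² k)) ⟩
    sign d * (sign k * sign k)
      ≡⟨ sym (ℤ.*-assoc (sign d) (sign k) (sign k)) ⟩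
    sign d * sign k * sign k
      ≡⟨ cong (λ s → sign d * s * sign k) (sym sign-3k) ⟩
    sign d * sign (3 ℕ.* k) * sign k
      ≡⟨ cong (_* sign k) (sym (sign-+ d (3 ℕ.* k))) ⟩
    sign (d ℕ.+ 3 ℕ.* k) * sign k
      ≡⟨ cong (λ j → sign j * sign k) (ℕ.m∸n+n≡m h) ⟩
    sign n * sign k ∎

cubic-diagonal : ∀ n → iterate cubic diagonal n 0 0 0 ≡ sign n * B n
cubic-diagonal n = begin
  iterate cubic diagonal n 0 0 0
    ≡⟨ cubic-expand n ℕ.≤-refl diagonal 0 0 0 ⟩
  (sumTo n λ i → binom₋₃ n i * iterate cubes diagonal i 0 0 0)
    ≡⟨ ext (sumTo-linear n) expand ⟩
  (sumTo n λ i → sumTo n λ x → binom₋₃ n i * + trinomial i x x x)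
    -- With x outermost, the sum over i reduces to the single term i = 3x.
    ≡⟨ swap (commute-sumTo (sumTo-linear n) n) (λ i x → binom₋₃ n i * + trinomial i x x x) ⟩
  (sumTo n λ x → sumTo n λ i → binom₋₃ n i * + trinomial i x x x)
    ≡⟨ ext (sumTo-linear n) (λ x → sumTo-single n (3 ℕ.* x) (off x)
         (λ h → trans (cong (_* + trinomial (3 ℕ.* x) x x x) (binom₋₃≡0 h)) (ℤ.*-zeroˡ (+ trinomial (3 ℕ.* x) x x x)))) ⟩
  (sumTo n λ x → binom₋₃ n (3 ℕ.* x) * + trinomial (3 ℕ.* x) x x x)
    ≡⟨ ext (sumTo-linear n) (signed-B-term n) ⟩
  (sumTo n λ x → sign n * B-term n x)
    ≡⟨ mulˡ (sumTo-linear n) (sign n) (B-term n) ⟩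
  sign n * sumTo n (B-term n)
    ≡⟨ cong (sign n *_) (sym (B-extended n)) ⟩
  sign n * B n ∎
  where
  open ≡-Reasoning
  expand : ∀ i → binom₋₃ n i * iterate cubes diagonal i 0 0 0 ≡ sumTo n λ x → binom₋₃ n i * + trinomial i x x x
  expand i with i ℕ.≤? n
  ... | yes h = trans (cong (binom₋₃ n i *_) (cubes-diagonal h)) (sym (mulˡ (sumTo-linear n) (binom₋₃ n i) _))
  ... | no h = trans (cong (_* iterate cubes diagonal i 0 0 0) (binom₋₃≡0 (ℕ.≰⇒> h)))
      (sym (zeros (sumTo-linear n) λ x → trans (cong (_* + trinomial i x x x) (binom₋₃≡0 (ℕ.≰⇒> h))) (ℤ.*-zeroˡ (+ trinomial i x x x))))
  off : ∀ x i → i ≢ 3 ℕ.* x → binom₋₃ n i * + trinomial i x x x ≡ 0ℤ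
  off x i h = trans (cong (λ t → binom₋₃ n i * + t) (trinomial≡0 i x x x λ eq → h (trans (sym eq) (lem x))))
    (ℤ.*-zeroʳ (binom₋₃ n i))
    where
    lem : ∀ x → x ℕ.+ x ℕ.+ x ≡ 3 ℕ.* x
    lem = ℕ.solve-∀

-- Zagier's sequence as a sum over matrices

onDiagonal : Row → ℤ
onDiagonal (a , b , c) = diagonal a b c

rowExponent : Row → ℕ
rowExponent (a , b , c) = b ℕ.+ 2 ℕ.* c

exponent : Mat → ℕ
exponent (r , s , t) = rowExponent s ℕ.+ 2 ℕ.* rowExponent t

-- The function of the exponent is a parameter: besides `ψ`, its composite with multiplication by p
-- and the indicator `[3∤_]` will occur.
summand : ℕ → (ℕ → ℤ) → Mat → ℤ
summand n φ m = + weight n m * (onDiagonal (columnSums m) * φ (exponent m))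

-- The factor 2 is ψ 0: the coefficient is rational, and its trace is twice its value.
matrix-formula : ∀ {m} n → n ℕ.≤ m → mat m (summand n ψ) ≡ + 2 * (sign n * B n)
matrix-formula {m} n n≤m = sym (begin
  + 2 * (sign n * B n)
    ≡⟨ cong (+ 2 *_) (sym (cubic-diagonal n)) ⟩
  + 2 * iterate cubic diagonal n 0 0 0
    ≡⟨ ℤ.*-comm (+ 2) _ ⟩
  twist (iterate cubic diagonal n) 0 0 0 0
    ≡⟨ sym (iterate-norm-twist {diagonal} (λ _ _ _ → refl) n 0 0 0 0) ⟩
  iterate norm F n 0 0 0 0
    ≡⟨ iterate-norm n F 0 0 0 0 ⟩
  iterate L₀ G₁ n 0 0 0 0
    ≡⟨ shift-expand n n≤m G₁ 0 0 0 0 ⟩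
  box m (λ r → + coeff n r * G₁ (x-of r) (y-of r) (z-of r) (e₀ r))
    ≡⟨ ext (box-linear m) (λ r → trans
         (cong (+ coeff n r *_) (shift-expand n n≤m G₂ (x-of r) (y-of r) (z-of r) (e₀ r)))
         (sym (mulˡ (box-linear m) (+ coeff n r) _))) ⟩
  box m (λ r → box m λ s → + coeff n r * (+ coeff n s *
    G₂ (proj₁ s ℕ.* 1 ℕ.+ x-of r) (proj₁ (proj₂ s) ℕ.* 1 ℕ.+ y-of r) (proj₂ (proj₂ s) ℕ.* 1 ℕ.+ z-of r) (e₁ r s)))
    ≡⟨ ext (box-linear m) (λ r → ext (box-linear m) λ s → last r s) ⟩
  mat m (summand n ψ) ∎)
  where
  open ≡-Reasoning
  F G₁ G₂ : Test
  F = twist diagonal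
  G₂ = iterate L₂ F n
  G₁ = iterate L₁ G₂ n
  x-of y-of z-of e₀ : Row → ℕ
  x-of (a , _ , _) = a ℕ.* 1 ℕ.+ 0
  y-of (_ , b , _) = b ℕ.* 1 ℕ.+ 0
  z-of (_ , _ , c) = c ℕ.* 1 ℕ.+ 0
  e₀ (_ , b , c) = b ℕ.* 0 ℕ.+ (c ℕ.* 0 ℕ.+ 0)
  e₁ : Row → Row → ℕ
  e₁ r (_ , b , c) = b ℕ.* 1 ℕ.+ (c ℕ.* 2 ℕ.+ e₀ r)
  assoc : ∀ x y z w → x * (y * (z * w)) ≡ x * y * z * w
  assoc = solve-∀
  column : ∀ a a′ a″ → a″ ℕ.* 1 ℕ.+ (a′ ℕ.* 1 ℕ.+ (a ℕ.* 1 ℕ.+ 0)) ≡ a ℕ.+ a′ ℕ.+ a″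
  column = ℕ.solve-∀
  exponents : ∀ b c b′ c′ b″ c″ →
    b″ ℕ.* 2 ℕ.+ (c″ ℕ.* 4 ℕ.+ (b′ ℕ.* 1 ℕ.+ (c′ ℕ.* 2 ℕ.+ (b ℕ.* 0 ℕ.+ (c ℕ.* 0 ℕ.+ 0))))) ≡
    (b′ ℕ.+ 2 ℕ.* c′) ℕ.+ 2 ℕ.* (b″ ℕ.+ 2 ℕ.* c″)
  exponents = ℕ.solve-∀
  last : ∀ r s → + coeff n r * (+ coeff n s * G₂ (proj₁ s ℕ.* 1 ℕ.+ x-of r)
      (proj₁ (proj₂ s) ℕ.* 1 ℕ.+ y-of r) (proj₂ (proj₂ s) ℕ.* 1 ℕ.+ z-of r) (e₁ r s)) ≡
    box m (λ t → summand n ψ (r , s , t))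
  last r@(a , b , c) s@(a′ , b′ , c′) = trans
    (cong (λ x → + coeff n r * (+ coeff n s * x)) (shift-expand n n≤m F _ _ _ _))
    (trans (cong (+ coeff n r *_) (sym (mulˡ (box-linear m) (+ coeff n s) _)))
    (trans (sym (mulˡ (box-linear m) (+ coeff n r) _))
    (ext (box-linear m) λ { t@(a″ , b″ , c″) → trans (assoc (+ coeff n r) (+ coeff n s) (+ coeff n t) _)
      (cong₂ _*_ (sym (pos-*³ (coeff n r) (coeff n s) (coeff n t)))
        (cong₂ _*_ (cong₂ _*_ (cong₂ δ (column a a′ a″) (column b b′ b″)) (cong₂ δ (column b b′ b″) (column c c′ c″)))
          (cong ψ (exponents b c b′ c′ b″ c″)))) })))

-- Multiplication of matrices by p

coeff-·ᴿ≡0 : ∀ p n r → .{{ℕ.NonZero p}} → rowSum r ≢ n → coeff (p ℕ.* n) (p ·ᴿ r) ≡ 0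
coeff-·ᴿ≡0 p n r h = coeff≡0 (p ℕ.* n) (p ·ᴿ r) λ eq →
  h (ℕ.*-cancelˡ-≡ (rowSum r) n p (trans (sym (rowSum-·ᴿ p r)) eq))

weight≡0 : ∀ n r s t → coeff n r ≡ 0 ⊎ coeff n s ≡ 0 ⊎ coeff n t ≡ 0 → weight n (r , s , t) ≡ 0
weight≡0 n r s t (inj₁ h) rewrite h = refl
weight≡0 n r s t (inj₂ (inj₁ h)) rewrite h | ℕ.*-zeroʳ (coeff n r) = refl
weight≡0 n r s t (inj₂ (inj₂ h)) rewrite h = ℕ.*-zeroʳ (coeff n r ℕ.* coeff n s)

-- `bad-row` also covers the multiples of `m`, since `m` is always compared with p m; for
-- `unbalanced` this follows from `onDiagonal-·ᴹ`.
data Support (n : ℕ) (m : Mat) : Set where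
  magic     : Magic n m → Support n m
  bad-row   : weight n m ≡ 0 → (∀ p → .{{ℕ.NonZero p}} → weight (p ℕ.* n) (p ·ᴹ m) ≡ 0) → Support n m
  unbalanced : onDiagonal (columnSums m) ≡ 0ℤ → Support n m

support : ∀ n m → Support n m
support n m@(r , s , t) with rowSum r ℕ.≟ n | rowSum s ℕ.≟ n | rowSum t ℕ.≟ n
... | no h | _ | _ = bad-row (weight≡0 n r s t (inj₁ (coeff≡0 n r h)))
  λ p → weight≡0 (p ℕ.* n) (p ·ᴿ r) (p ·ᴿ s) (p ·ᴿ t) (inj₁ (coeff-·ᴿ≡0 p n r h))
... | yes _ | no h | _ = bad-row (weight≡0 n r s t (inj₂ (inj₁ (coeff≡0 n s h))))
  λ p → weight≡0 (p ℕ.* n) (p ·ᴿ r) (p ·ᴿ s) (p ·ᴿ t) (inj₂ (inj₁ (coeff-·ᴿ≡0 p n s h)))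
... | yes _ | yes _ | no h = bad-row (weight≡0 n r s t (inj₂ (inj₂ (coeff≡0 n t h))))
  λ p → weight≡0 (p ℕ.* n) (p ·ᴿ r) (p ·ᴿ s) (p ·ᴿ t) (inj₂ (inj₂ (coeff-·ᴿ≡0 p n t h)))
... | yes hr | yes hs | yes ht with columnSums m in eq
...   | (x , y , z) with x ℕ.≟ y | y ℕ.≟ z
...     | no h | _ = unbalanced (trans (cong onDiagonal eq) (trans (cong (_* δ y z) (δ≡0 h)) (ℤ.*-zeroˡ (δ y z))))
...     | yes _ | no h = unbalanced (trans (cong onDiagonal eq) (trans (cong (δ x y *_) (δ≡0 h)) (ℤ.*-zeroʳ (δ x y))))
-- Equal column sums must be n, because rows and columns both total 3 n.
...     | yes refl | yes refl = magic record
  { row₁ = hr ; row₂ = hs ; row₃ = ht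
  ; columns = trans eq (cong (λ k → k , k , k) (ℕ.*-cancelʳ-≡ x n 3 x*3≡n*3)) }
  where
  total : ∀ r s t → rowSum (columnSums (r , s , t)) ≡ rowSum r ℕ.+ rowSum s ℕ.+ rowSum t
  total (a , b , c) (a′ , b′ , c′) (a″ , b″ , c″) = lem a b c a′ b′ c′ a″ b″ c″
    where
    lem : ∀ a b c a′ b′ c′ a″ b″ c″ →
      (a ℕ.+ a′ ℕ.+ a″) ℕ.+ (b ℕ.+ b′ ℕ.+ b″) ℕ.+ (c ℕ.+ c′ ℕ.+ c″) ≡
      (a ℕ.+ b ℕ.+ c) ℕ.+ (a′ ℕ.+ b′ ℕ.+ c′) ℕ.+ (a″ ℕ.+ b″ ℕ.+ c″)
    lem = ℕ.solve-∀
  triple : ∀ x → x ℕ.+ x ℕ.+ x ≡ x ℕ.* 3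
  triple = ℕ.solve-∀
  x*3≡n*3 : x ℕ.* 3 ≡ n ℕ.* 3
  x*3≡n*3 = trans (sym (triple x)) (trans (sym (cong rowSum eq)) (trans (total r s t)
    (trans (cong₂ ℕ._+_ (cong₂ ℕ._+_ hr hs) ht) (triple n))))

weight≡0⇒summand≡0 : ∀ {n m} φ → weight n m ≡ 0 → summand n φ m ≡ 0ℤ
weight≡0⇒summand≡0 {n} {m} φ h = trans (cong (λ w → + w * (onDiagonal (columnSums m) * φ (exponent m))) h)
  (ℤ.*-zeroˡ (onDiagonal (columnSums m) * φ (exponent m)))

unbalanced⇒summand≡0 : ∀ {n m} φ → onDiagonal (columnSums m) ≡ 0ℤ → summand n φ m ≡ 0ℤ
unbalanced⇒summand≡0 {n} {m} φ h = trans (cong (λ d → + weight n m * (d * φ (exponent m))) h)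
  (trans (cong (+ weight n m *_) (ℤ.*-zeroˡ (φ (exponent m)))) (ℤ.*-zeroʳ (+ weight n m)))

δ-* : ∀ p a b → .{{ℕ.NonZero p}} → δ (p ℕ.* a) (p ℕ.* b) ≡ δ a b
δ-* p a b with a ℕ.≟ b
... | yes refl = trans (δ-refl (p ℕ.* a)) (sym (δ-refl a))
... | no h     = trans (δ≡0 (h ∘ ℕ.*-cancelˡ-≡ a b p)) (sym (δ≡0 h))

columnSums-·ᴹ : ∀ p m → columnSums (p ·ᴹ m) ≡ p ·ᴿ columnSums m
columnSums-·ᴹ p ((a , b , c) , (a′ , b′ , c′) , (a″ , b″ , c″)) =
  cong₂ _,_ (lem p a a′ a″) (cong₂ _,_ (lem p b b′ b″) (lem p c c′ c″))
  where
  lem : ∀ p x y z → p ℕ.* x ℕ.+ p ℕ.* y ℕ.+ p ℕ.* z ≡ p ℕ.* (x ℕ.+ y ℕ.+ z)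
  lem = ℕ.solve-∀

onDiagonal-·ᴹ : ∀ p m → .{{ℕ.NonZero p}} → onDiagonal (columnSums (p ·ᴹ m)) ≡ onDiagonal (columnSums m)
onDiagonal-·ᴹ p m = trans (cong onDiagonal (columnSums-·ᴹ p m)) (cong₂ _*_ (δ-* p _ _) (δ-* p _ _))

exponent-·ᴹ : ∀ p m → exponent (p ·ᴹ m) ≡ p ℕ.* exponent m
exponent-·ᴹ p (_ , (_ , b′ , c′) , (_ , b″ , c″)) = lem p b′ c′ b″ c″
  where
  lem : ∀ p b c b′ c′ → (p ℕ.* b ℕ.+ 2 ℕ.* (p ℕ.* c)) ℕ.+ 2 ℕ.* (p ℕ.* b′ ℕ.+ 2 ℕ.* (p ℕ.* c′)) ≡
    p ℕ.* ((b ℕ.+ 2 ℕ.* c) ℕ.+ 2 ℕ.* (b′ ℕ.+ 2 ℕ.* c′))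
  lem = ℕ.solve-∀

module _ {q : ℕ} (pp : Prime (suc q)) (sq : sign q ≡ 1ℤ) where
  private
    p : ℕ
    p = suc q

  ∣summand : ∀ {n} k φ m → p ^ k ℕ.∣ n → ¬ p ∣ᴹ m → + (p ^ (k ℕ.+ k)) ∣ summand n φ m
  ∣summand {n} k φ m d h with support n m
  ... | magic mag    = ∣m⇒∣m*n _ (pos-∣ (∣weight pp k mag d h))
  ... | bad-row z _  = subst (+ (p ^ (k ℕ.+ k)) ∣_) (sym (weight≡0⇒summand≡0 {n} {m} φ z)) (divides 0ℤ refl)
  ... | unbalanced z = subst (+ (p ^ (k ℕ.+ k)) ∣_) (sym (unbalanced⇒summand≡0 {n} {m} φ z)) (divides 0ℤ refl)

  summand-·ᴹ : ∀ {n} k φ m → p ^ k ℕ.∣ n →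
    summand (p ℕ.* n) φ (p ·ᴹ m) ≡ summand n (φ ∘ (p ℕ.*_)) m [mod + (p ^ (2 ℕ.* suc k)) ]
  summand-·ᴹ {n} k φ m d with support n m
  ... | magic mag = mod-* (weight-cong pp sq k 0 mag ones d)
    (≡⇒mod (cong₂ (λ x e → x * φ e) (onDiagonal-·ᴹ p m) (exponent-·ᴹ p m)))
    where
    ones : 1 ∣ᴹ m
    ones = (ℕ.1∣ _ , ℕ.1∣ _ , ℕ.1∣ _) , (ℕ.1∣ _ , ℕ.1∣ _ , ℕ.1∣ _) , (ℕ.1∣ _ , ℕ.1∣ _ , ℕ.1∣ _)
  ... | bad-row z z′ = ≡⇒mod (trans (weight≡0⇒summand≡0 {p ℕ.* n} {p ·ᴹ m} φ (z′ p))
                                    (sym (weight≡0⇒summand≡0 {n} {m} (φ ∘ (p ℕ.*_)) z)))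
  ... | unbalanced z = ≡⇒mod (trans (unbalanced⇒summand≡0 {p ℕ.* n} {p ·ᴹ m} φ (trans (onDiagonal-·ᴹ p m) z))
                                    (sym (unbalanced⇒summand≡0 {n} {m} (φ ∘ (p ℕ.*_)) z)))

  matrix-sum-contracts : ∀ {n} k φ → p ^ k ℕ.∣ n →
    mat (p ℕ.* n) (summand (p ℕ.* n) φ) ≡ mat n (summand n (φ ∘ (p ℕ.*_))) [mod + (p ^ (2 ℕ.* suc k)) ]
  matrix-sum-contracts {n} k φ d = mod-trans
    (contract (mat-contracts p _ n) (summand (p ℕ.* n) φ) λ m h →
      -- The exponent is `suc k` because the row sums are p n here.
      subst (λ j → + (p ^ j) ∣ summand (p ℕ.* n) φ m) (cong (suc k ℕ.+_) (sym (ℕ.+-identityʳ (suc k))))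
        (∣summand (suc k) φ m (ℕ.*-monoʳ-∣ p d) h))
    (congMod (mat-linear n) λ m → summand-·ᴹ k φ m d)

-- Powers of ω and residues modulo 3

Periodic : (ℕ → ℤ) → Set
Periodic φ = ∀ e → φ (3 ℕ.+ e) ≡ φ e

periodic-+* : ∀ {φ} → Periodic φ → ∀ k r → φ (k ℕ.* 3 ℕ.+ r) ≡ φ r
periodic-+* h zero    r = refl
periodic-+* h (suc k) r = trans (h (k ℕ.* 3 ℕ.+ r)) (periodic-+* h k r)

ψ-double : ∀ e → ψ (e ℕ.+ e) ≡ ψ e
ψ-double 0 = refl
ψ-double 1 = refl
ψ-double 2 = refl
ψ-double (suc (suc (suc e))) = trans (cong ψ (lem e)) (ψ-double e)
  where
  lem : ∀ e → e ℕ.+ (3 ℕ.+ e) ≡ 3 ℕ.+ (e ℕ.+ e)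
  lem = ℕ.solve-∀

-- Since p ≡ ±1 modulo 3, ω ↦ ω^p is the identity or the conjugation, and both preserve the trace.
ψ-prime : ∀ {p} → Prime p → p ≢ 3 → ∀ e → ψ (p ℕ.* e) ≡ ψ e
ψ-prime {p} pp p≢3 e with p divMod 3
... | result k 0F refl with prime⇒irreducible pp (ℕ.n∣m*n k)
...   | inj₂ 3≡p = ⊥-elim (p≢3 (sym 3≡p))
ψ-prime pp p≢3 e | result k (sucF 0F) refl = trans (cong ψ (lem k e)) (periodic-+* {ψ} (λ _ → refl) (k ℕ.* e) e)
  where
  lem : ∀ k e → (1 ℕ.+ k ℕ.* 3) ℕ.* e ≡ k ℕ.* e ℕ.* 3 ℕ.+ e
  lem = ℕ.solve-∀
ψ-prime pp p≢3 e | result k (sucF (sucF 0F)) refl =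
  trans (cong ψ (lem k e)) (trans (periodic-+* {ψ} (λ _ → refl) (k ℕ.* e) (e ℕ.+ e)) (ψ-double e))
  where
  lem : ∀ k e → (2 ℕ.+ k ℕ.* 3) ℕ.* e ≡ k ℕ.* e ℕ.* 3 ℕ.+ (e ℕ.+ e)
  lem = ℕ.solve-∀

[3∣_] [3∤_] : ℕ → ℤ
[3∣ 0 ] = 1ℤ
[3∣ 1 ] = 0ℤ
[3∣ 2 ] = 0ℤ
[3∣ suc (suc (suc e)) ] = [3∣ e ]
[3∤ 0 ] = 0ℤ
[3∤ 1 ] = 1ℤ
[3∤ 2 ] = 1ℤ
[3∤ suc (suc (suc e)) ] = [3∤ e ]

-- The trace is 2 at 1 and -1 at a primitive cube root of unity; the gap 3 is one of the two factors
-- 3 needed beyond 3^(2k).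
ψ-triple : ∀ e → ψ (3 ℕ.* e) ≡ ψ e + [3∤ e ] * + 3
ψ-triple e = trans (trans (cong ψ (lem e)) (periodic-+* {ψ} (λ _ → refl) e 0)) (trace e)
  where
  lem : ∀ e → 3 ℕ.* e ≡ e ℕ.* 3 ℕ.+ 0
  lem = ℕ.solve-∀
  trace : ∀ e → + 2 ≡ ψ e + [3∤ e ] * + 3
  trace 0 = refl
  trace 1 = refl
  trace 2 = refl
  trace (suc (suc (suc e))) = trace e

-- For a matrix with row exponents x, y, z, the three terms belong to its cyclic rotations: each
-- tests the exponent of the rotated matrix and its first row.
rotations : ℕ → ℕ → ℕ → ℤ
rotations x y z = [3∤ y ℕ.+ 2 ℕ.* z ] * [3∣ x ] + [3∤ z ℕ.+ 2 ℕ.* x ] * [3∣ y ] + [3∤ x ℕ.+ 2 ℕ.* y ] * [3∣ z ]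

rotations-residues : ∀ (r s t : Fin 3) → [3∣ toℕ r ℕ.+ toℕ s ℕ.+ toℕ t ] ≡ 1ℤ →
  [3∤ toℕ s ℕ.+ 2 ℕ.* toℕ t ] ≡ rotations (toℕ r) (toℕ s) (toℕ t)
rotations-residues = from-yes (all? {n = 3} λ r → all? {n = 3} λ s → all? {n = 3} λ t →
  ([3∣ toℕ r ℕ.+ toℕ s ℕ.+ toℕ t ] ℤ.≟ 1ℤ) →-dec
  ([3∤ toℕ s ℕ.+ 2 ℕ.* toℕ t ] ℤ.≟ rotations (toℕ r) (toℕ s) (toℕ t)))

-- If x + y + z ≡ 0 but y ≢ z modulo 3, then exactly one of x, y, z is divisible by 3.
rotation-partition : ∀ n x y z → x ℕ.+ y ℕ.+ z ≡ n ℕ.* 3 →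
  [3∤ y ℕ.+ 2 ℕ.* z ] ≡ rotations x y z
rotation-partition n x y z h with x divMod 3 | y divMod 3 | z divMod 3
... | result i r refl | result j s refl | result k t refl = begin
  [3∤ (toℕ s ℕ.+ j ℕ.* 3) ℕ.+ 2 ℕ.* (toℕ t ℕ.+ k ℕ.* 3) ]
    ≡⟨ coprime s j t k ⟩
  [3∤ toℕ s ℕ.+ 2 ℕ.* toℕ t ]
    ≡⟨ rotations-residues r s t (trans (sym total) (trans (cong [3∣_] h) multiple)) ⟩
  rotations (toℕ r) (toℕ s) (toℕ t)
    ≡⟨ sym (cong₂ _+_ (cong₂ _+_ (cong₂ _*_ (coprime s j t k) (divisible r i))
         (cong₂ _*_ (coprime t k r i) (divisible s j))) (cong₂ _*_ (coprime r i s j) (divisible t k))) ⟩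
  rotations (toℕ r ℕ.+ i ℕ.* 3) (toℕ s ℕ.+ j ℕ.* 3) (toℕ t ℕ.+ k ℕ.* 3) ∎
  where
  open ≡-Reasoning
  coprime : ∀ (s : Fin 3) j (t : Fin 3) k →
    [3∤ (toℕ s ℕ.+ j ℕ.* 3) ℕ.+ 2 ℕ.* (toℕ t ℕ.+ k ℕ.* 3) ] ≡ [3∤ toℕ s ℕ.+ 2 ℕ.* toℕ t ]
  coprime s j t k = trans (cong [3∤_] (lem (toℕ s) j (toℕ t) k)) (periodic-+* {[3∤_]} (λ _ → refl) (j ℕ.+ 2 ℕ.* k) _)
    where
    lem : ∀ s j t k → (s ℕ.+ j ℕ.* 3) ℕ.+ 2 ℕ.* (t ℕ.+ k ℕ.* 3) ≡ (j ℕ.+ 2 ℕ.* k) ℕ.* 3 ℕ.+ (s ℕ.+ 2 ℕ.* t)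
    lem = ℕ.solve-∀
  divisible : ∀ (r : Fin 3) i → [3∣ toℕ r ℕ.+ i ℕ.* 3 ] ≡ [3∣ toℕ r ]
  divisible r i = trans (cong [3∣_] (ℕ.+-comm (toℕ r) (i ℕ.* 3))) (periodic-+* {[3∣_]} (λ _ → refl) i _)
  total : [3∣ toℕ r ℕ.+ i ℕ.* 3 ℕ.+ (toℕ s ℕ.+ j ℕ.* 3) ℕ.+ (toℕ t ℕ.+ k ℕ.* 3) ] ≡ [3∣ toℕ r ℕ.+ toℕ s ℕ.+ toℕ t ]
  total = trans (cong [3∣_] (lem (toℕ r) i (toℕ s) j (toℕ t) k)) (periodic-+* {[3∣_]} (λ _ → refl) (i ℕ.+ j ℕ.+ k) _)
    where
    lem : ∀ r i s j t k → (r ℕ.+ i ℕ.* 3) ℕ.+ (s ℕ.+ j ℕ.* 3) ℕ.+ (t ℕ.+ k ℕ.* 3) ≡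
      (i ℕ.+ j ℕ.+ k) ℕ.* 3 ℕ.+ (r ℕ.+ s ℕ.+ t)
    lem = ℕ.solve-∀
  multiple : [3∣ n ℕ.* 3 ] ≡ 1ℤ
  multiple = trans (cong [3∣_] (sym (ℕ.+-identityʳ (n ℕ.* 3)))) (periodic-+* {[3∣_]} (λ _ → refl) n 0)

-- Rotation of matrices

rotate : Mat → Mat
rotate (r , s , t) = s , t , r

weight-rotate : ∀ n m → weight n (rotate m) ≡ weight n m
weight-rotate n (r , s , t) = lem (coeff n r) (coeff n s) (coeff n t)
  where
  lem : ∀ x y z → y ℕ.* z ℕ.* x ≡ x ℕ.* y ℕ.* z
  lem = ℕ.solve-∀

columnSums-rotate : ∀ m → columnSums (rotate m) ≡ columnSums m
columnSums-rotate ((a , b , c) , (a′ , b′ , c′) , (a″ , b″ , c″)) =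
  cong₂ _,_ (lem a a′ a″) (cong₂ _,_ (lem b b′ b″) (lem c c′ c″))
  where
  lem : ∀ x y z → y ℕ.+ z ℕ.+ x ≡ x ℕ.+ y ℕ.+ z
  lem = ℕ.solve-∀

-- This selects one matrix from each rotation orbit: if the sums are all n and 3 does not divide the
-- exponent, exactly one of the rotations has a first row with exponent divisible by 3.
sieved : ℕ → Mat → ℤ
sieved n m = summand n [3∤_] m * [3∣ rowExponent (proj₁ m) ]

summand-rotations : ∀ n m → summand n [3∤_] m ≡ sieved n m + sieved n (rotate m) + sieved n (rotate (rotate m))
summand-rotations n m@(r , s , t) = trans on-support (sym collect)
  where
  x = rowExponent r
  y = rowExponent s
  z = rowExponent t
  W D : ℤ
  W = + weight n m
  D = onDiagonal (columnSums m)
  turn : ∀ m → + weight n (rotate m) * (onDiagonal (columnSums (rotate m)) * [3∤ exponent (rotate m) ]) ≡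
               + weight n m * (onDiagonal (columnSums m) * [3∤ exponent (rotate m) ])
  turn m = cong₂ (λ w c → + w * (onDiagonal c * [3∤ exponent (rotate m) ])) (weight-rotate n m) (columnSums-rotate m)
  turn₂ : summand n [3∤_] (rotate (rotate m)) ≡ W * (D * [3∤ x ℕ.+ 2 ℕ.* y ])
  turn₂ = trans (turn (rotate m)) (cong₂ (λ w c → + w * (onDiagonal c * [3∤ x ℕ.+ 2 ℕ.* y ]))
    (weight-rotate n m) (columnSums-rotate m))
  distrib : ∀ w d a b c x y z → w * (d * a) * x + w * (d * b) * y + w * (d * c) * z ≡ w * (d * (a * x + b * y + c * z))
  distrib = solve-∀
  collect : sieved n m + sieved n (rotate m) + sieved n (rotate (rotate m)) ≡ W * (D * rotations x y z)
  collect = trans (cong₂ (λ u v → sieved n m + u * [3∣ y ] + v * [3∣ z ]) (turn m) turn₂)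
    (distrib W D [3∤ y ℕ.+ 2 ℕ.* z ] [3∤ z ℕ.+ 2 ℕ.* x ] [3∤ x ℕ.+ 2 ℕ.* y ] [3∣ x ] [3∣ y ] [3∣ z ])
  exponent-sum : ∀ r s t → rowExponent r ℕ.+ rowExponent s ℕ.+ rowExponent t ≡
    proj₁ (proj₂ (columnSums (r , s , t))) ℕ.+ 2 ℕ.* proj₂ (proj₂ (columnSums (r , s , t)))
  exponent-sum (_ , b , c) (_ , b′ , c′) (_ , b″ , c″) = lem b c b′ c′ b″ c″
    where
    lem : ∀ b c b′ c′ b″ c″ → (b ℕ.+ 2 ℕ.* c) ℕ.+ (b′ ℕ.+ 2 ℕ.* c′) ℕ.+ (b″ ℕ.+ 2 ℕ.* c″) ≡
      (b ℕ.+ b′ ℕ.+ b″) ℕ.+ 2 ℕ.* (c ℕ.+ c′ ℕ.+ c″)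
    lem = ℕ.solve-∀
  triple : ∀ n → n ℕ.+ 2 ℕ.* n ≡ n ℕ.* 3
  triple = ℕ.solve-∀
  on-support : W * (D * [3∤ y ℕ.+ 2 ℕ.* z ]) ≡ W * (D * rotations x y z)
  on-support with support n m
  ... | bad-row h _ rewrite h = trans (ℤ.*-zeroˡ (D * [3∤ y ℕ.+ 2 ℕ.* z ])) (sym (ℤ.*-zeroˡ (D * rotations x y z)))
  ... | unbalanced h = cong (W *_) (trans (cong (_* [3∤ y ℕ.+ 2 ℕ.* z ]) h)
    (trans (trans (ℤ.*-zeroˡ [3∤ y ℕ.+ 2 ℕ.* z ]) (sym (ℤ.*-zeroˡ (rotations x y z)))) (sym (cong (_* rotations x y z) h))))
  -- All columns sum to n, so the row exponents add up to n + 2n = 3n.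
  ... | magic mag = cong (λ v → W * (D * v)) (rotation-partition n x y z (trans (exponent-sum r s t)
    (trans (cong₂ (λ u v → u ℕ.+ 2 ℕ.* v) (cong (proj₁ ∘ proj₂) (columns mag)) (cong (proj₂ ∘ proj₂) (columns mag)))
           (triple n))))

sum-rotations : ∀ n → mat n (summand n [3∤_]) ≡ mat n (sieved n) * + 3
sum-rotations n = begin
  mat n (summand n [3∤_])
    ≡⟨ ext L (summand-rotations n) ⟩
  mat n (λ m → sieved n m + sieved n (rotate m) + sieved n (rotate (rotate m)))
    ≡⟨ add L _ _ ⟩
  mat n (λ m → sieved n m + sieved n (rotate m)) + mat n (sieved n ∘ rotate ∘ rotate)
    ≡⟨ cong₂ _+_ (add L _ _) (mat-rotate n (sieved n ∘ rotate)) ⟩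
  mat n (sieved n) + mat n (sieved n ∘ rotate) + mat n (sieved n ∘ rotate)
    ≡⟨ cong (λ u → mat n (sieved n) + u + u) (mat-rotate n (sieved n)) ⟩
  mat n (sieved n) + mat n (sieved n) + mat n (sieved n)
    ≡⟨ triple (mat n (sieved n)) ⟩
  mat n (sieved n) * + 3 ∎
  where
  open ≡-Reasoning
  L = mat-linear n
  triple : ∀ x → x + x + x ≡ x * + 3
  triple = solve-∀

-- A matrix divisible by 3 has an exponent divisible by 3, so `[3∤_]` removes every matrix to which
-- `∣summand` does not apply.
∣sieved : Prime 3 → ∀ {n} k → 3 ^ k ℕ.∣ n → ∀ m → + (3 ^ (k ℕ.+ k)) ∣ sieved n m
∣sieved pp {n} k d m with 3 ℕ.∣? exponent m
... | yes (ℕ.divides j eq) = ∣m⇒∣m*n _ (∣n⇒∣m*n (+ weight n m) (∣n⇒∣m*n (onDiagonal (columnSums m))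
  (subst (+ (3 ^ (k ℕ.+ k)) ∣_) (sym vanish) (divides 0ℤ refl))))
  where
  vanish : [3∤ exponent m ] ≡ 0ℤ
  vanish = trans (cong [3∤_] (trans eq (sym (ℕ.+-identityʳ (j ℕ.* 3))))) (periodic-+* {[3∤_]} (λ _ → refl) j 0)
... | no h = ∣m⇒∣m*n _ (∣summand pp refl k [3∤_] m d λ { (_ , (_ , b , c) , (_ , b′ , c′)) →
  h (ℕ.∣m∣n⇒∣m+n (ℕ.∣m∣n⇒∣m+n b (ℕ.∣n⇒∣m*n 2 c)) (ℕ.∣n⇒∣m*n 2 (ℕ.∣m∣n⇒∣m+n b′ (ℕ.∣n⇒∣m*n 2 c′)))) })

matrix-sum-triple : Prime 3 → ∀ {n} k → 3 ^ k ℕ.∣ n →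
  mat n (summand n (ψ ∘ (3 ℕ.*_))) ≡ mat n (summand n ψ) [mod + (3 ^ (2 ℕ.* suc k)) ]
matrix-sum-triple pp {n} k d = mod (subst₂ _∣_ power (sym difference)
  (*-pres-∣ (*-pres-∣ (dvd L (∣sieved pp k d)) (∣-refl {+ 3})) (∣-refl {+ 3})))
  where
  L = mat-linear n
  lem₁ : ∀ w d p c → w * (d * (p + c * + 3)) ≡ w * (d * p) + w * (d * c) * + 3
  lem₁ = solve-∀
  lem₂ : ∀ p c → (p + c) - p ≡ c
  lem₂ = solve-∀
  split : ∀ m → summand n (ψ ∘ (3 ℕ.*_)) m ≡ summand n ψ m + summand n [3∤_] m * + 3
  split m = trans (cong (λ v → + weight n m * (onDiagonal (columnSums m) * v)) (ψ-triple (exponent m)))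
    (lem₁ (+ weight n m) (onDiagonal (columnSums m)) (ψ (exponent m)) [3∤ exponent m ])
  difference : mat n (summand n (ψ ∘ (3 ℕ.*_))) - mat n (summand n ψ) ≡ mat n (sieved n) * + 3 * + 3
  difference = trans (cong (_- mat n (summand n ψ)) (trans (ext L split) (add L _ _)))
    (trans (lem₂ (mat n (summand n ψ)) _)
      (trans (mulʳ L (summand n [3∤_]) (+ 3)) (cong (_* + 3) (sum-rotations n))))
  power : + (3 ^ (k ℕ.+ k)) * + 3 * + 3 ≡ + (3 ^ (2 ℕ.* suc k))
  power = trans (sym (pos-*³ (3 ^ (k ℕ.+ k)) 3 3)) (cong +_ (trans (lem (3 ^ (k ℕ.+ k))) (cong (3 ^_) (lem′ k))))
    where
    lem : ∀ x → x ℕ.* 3 ℕ.* 3 ≡ 3 ℕ.* (3 ℕ.* x)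
    lem = ℕ.solve-∀
    lem′ : ∀ k → suc (suc (k ℕ.+ k)) ≡ 2 ℕ.* suc k
    lem′ = ℕ.solve-∀

-- The Frobenius map on ω and the supercongruence

matrix-sum-Frobenius : ∀ {p} → Prime p → ∀ {n} k → p ^ k ℕ.∣ n →
  mat n (summand n (ψ ∘ (p ℕ.*_))) ≡ mat n (summand n ψ) [mod + (p ^ (2 ℕ.* suc k)) ]
matrix-sum-Frobenius {p} pp {n} k d with p ℕ.≟ 3
... | yes refl = matrix-sum-triple pp k d
... | no h = ≡⇒mod (ext (mat-linear n) λ m →
  cong (λ v → + weight n m * (onDiagonal (columnSums m) * v)) (ψ-prime pp h (exponent m)))

parity : ∀ q → sign q ≡ 1ℤ ⊎ 2 ℕ.∣ suc q
parity zero = inj₁ refl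
parity (suc zero) = inj₂ (ℕ.divides 1 refl)
parity (suc (suc q)) with parity q
... | inj₁ h = inj₁ (trans (ℤ.neg-involutive (sign q)) h)
... | inj₂ h = inj₂ (ℕ.∣m∣n⇒∣m+n (ℕ.divides 1 refl) h)

odd-prime-sign : ∀ {q} → Prime (suc q) → suc q ≥ 3 → sign q ≡ 1ℤ
odd-prime-sign {q} pp p≥3 with parity q
... | inj₁ h = h
... | inj₂ h with prime⇒irreducible pp h
...   | inj₂ refl = ⊥-elim (ℕ.<-irrefl refl p≥3)

sign-* : ∀ q m → sign q ≡ 1ℤ → sign (q ℕ.* m) ≡ 1ℤ
sign-* q zero sq = cong sign (ℕ.*-zeroʳ q)
sign-* q (suc m) sq = trans (cong sign (ℕ.*-suc q m))
  (trans (sign-+ q (q ℕ.* m)) (cong₂ _*_ sq (sign-* q m sq)))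

-- As p is odd, (-1)^(p n) = (-1)^n. Multiplying by this sign once more removes it, and the 2 from
-- the trace is prime to p.
supercongruence : ∀ {q} → Prime (suc q) → sign q ≡ 1ℤ → ∀ {n} k → suc q ^ k ℕ.∣ n →
  B (suc q ℕ.* n) ≡ B n [mod + (suc q ^ (2 ℕ.* suc k)) ]
supercongruence {q} pp sq {n} k d = mod (prime-power-cancel pp (2 ℕ.* suc k) (odd⇒∤2 q pp sq)
  (subst (+ (suc q ^ (2 ℕ.* suc k)) ∣_) unsign (∣n⇒∣m*n (sign n) (diff doubled))))
  where
  doubled : + 2 * (sign n * B (suc q ℕ.* n)) ≡ + 2 * (sign n * B n) [mod + (suc q ^ (2 ℕ.* suc k)) ]
  doubled = mod-trans (≡⇒mod (trans (cong (λ s → + 2 * (s * B (suc q ℕ.* n))) (sym same-sign))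
      (sym (matrix-formula (suc q ℕ.* n) ℕ.≤-refl))))
    (mod-trans (matrix-sum-contracts pp sq k ψ d)
      (mod-trans (matrix-sum-Frobenius pp k d) (≡⇒mod (matrix-formula n ℕ.≤-refl))))
    where
    same-sign : sign (suc q ℕ.* n) ≡ sign n
    same-sign = trans (sign-+ n (q ℕ.* n)) (trans (cong (sign n *_) (sign-* q n sq)) (ℤ.*-identityʳ _))
  unsign : sign n * (+ 2 * (sign n * B (suc q ℕ.* n)) - + 2 * (sign n * B n)) ≡ + 2 * (B (suc q ℕ.* n) - B n)
  unsign = trans (lem (sign n) (B (suc q ℕ.* n)) (B n))
    (trans (cong (_* (+ 2 * (B (suc q ℕ.* n) - B n))) (sign² n)) (ℤ.*-identityˡ _))
    where
    lem : ∀ s x y → s * (+ 2 * (s * x) - + 2 * (s * y)) ≡ s * s * (+ 2 * (x - y))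
    lem = solve-∀

theorem1p4 : ∀ (p : ℕ) → Prime p → p ≥ 3 → ∀ (n k : ℕ) → n ≥ 1 → k ≥ 1 →
    (+ (p ^ (2 ℕ.* k))) ℤ.∣ (B (n ℕ.* p ^ k) - B (n ℕ.* p ^ (k ∸ 1)))
theorem1p4 p@(suc q) pp p≥3 n (suc k) _ _ = ∣⇒∣ᵤ (subst (λ N → + (p ^ (2 ℕ.* suc k)) ∣ B N - B (n ℕ.* p ^ k))
  (lem n p (p ^ k)) (diff (supercongruence pp (odd-prime-sign pp p≥3) k (ℕ.n∣m*n n))))
  where
  lem : ∀ n p x → p ℕ.* (n ℕ.* x) ≡ n ℕ.* (p ℕ.* x)
  lem = ℕ.solve-∀
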